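{- Let $G=(V,E)$ be an undirected graph, $k$ a positive integer, $S\subseteq V$, and $m_{\overline S}:V-S\to\mathbb{Z}$ an in-degree specification on $V-S$. Define $h:2^S\to\mathbb{Z}\cup\{ -\infty\}$ by $h(\emptyset)=0$, $h(S)=|E|-\widetilde m_{\overline S}(V-S)$, and $h(Z)=\max\{k+i_G(Z\cup X)-\widetilde m_{\overline S}(X):X\subseteq V-S\}$ for $\emptyset\subset Z\subset S$, and let $B_S=\{x\in\mathbb{R}^S:\widetilde x(S)=h(S),\ \widetilde x(Z)\ge h(Z)\ \forall Z\subset S\}$. Then the set of in-degree vectors of those orientations $D$ of $G$ which are locally $k$-edge-connected in $S$ and satisfy $\varrho_D(v)=m_{\overline S}(v)$ for all $v\in V-S$ is an M-convex set, namely it equals $\{(m_S,m_{\overline S}): m_S\in B_S\cap\mathbb{Z}^S\}$.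
   Context: $i_G(Y)$ is the number of edges with both end-nodes in $Y$; $\widetilde x(Z)=\sum_{v\in Z}x(v)$; $\varrho_D(v)$ is the number of arcs with head $v$. A digraph $D$ on $V$ is locally $k$-edge-connected in $S$ if for any two distinct nodes $s,t\in S$ there are $k$ arc-disjoint directed paths from $s$ to $t$ (equivalently, $\varrho_D(X)\ge k$ for every $X\subset V$ with $X\cap S$ and $S-X$ non-empty). An M-convex set is the set of integral points of an integral base-polyhedron.
   Formalization: The equality with {(m_S, m_S̄)} is stated for specifications m_S̄ that some orientation of G realizes on V−S; without this it fails (three parallel st-edges, S={s,t}, isolated u, m(u)=1, k=1). M-convexity is stated for every m_S̄, with the empty set counted as M-convex. -}

module Defs where

open import Algebra.Properties.CommutativeMonoid.Sum using () renaming (sum to sumIn)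
open import Data.Bool.Base using (Bool; if_then_else_)
open import Data.Bool.Properties using () renaming (_≟_ to _≟ᵇ_)
open import Data.Fin.Base using (Fin)
open import Data.Fin.Properties using () renaming (_≟_ to _≟ᶠ_)
open import Data.Fin.Subset using (Subset; inside; outside; _∈_; _⊂_; _∩_; _∪_; ∁; ∣_∣) renaming (⊥ to ∅; ⊤ to full)
open import Data.Fin.Subset.Properties using (_∈?_; x∉p⇒x∈∁p)
open import Data.Integer.Base using (ℤ; +_; 0ℤ; _+_; _-_; _⊔_; _≤_)
open import Data.Integer.Properties using (+-0-commutativeMonoid)
open import Data.List.Base using (List) renaming ([] to []ˡ; _∷_ to _∷ˡ_)
open import Data.List.Relation.Binary.Disjoint.Propositional using (Disjoint)
open import Data.List.Relation.Unary.Unique.Propositional using (Unique)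
open import Data.Nat.Base using (ℕ)
open import Data.Product.Base using (Σ; ∃; _×_; _,_; proj₁; proj₂; swap)
open import Data.Sum.Base using (_⊎_)
open import Data.Vec.Base using (Vec; []; _∷_; lookup; tabulate)
open import Data.Vec.Properties using (≡-dec)
open import Function.Bundles using (_⇔_)
open import Relation.Binary.PropositionalEquality.Core using (_≡_; _≢_)
open import Relation.Nullary.Construct.Add.Infimum using (_₋; ⊥₋; [_])
open import Relation.Nullary.Decidable using (Dec; yes; no; does; _×-dec_)
open import Relation.Nullary.Negation.Core using (¬_)

open import Relation.Binary.Construct.Add.Infimum.NonStrict _≤_ public using (_≤₋_)

-- Finite multigraphs on the node set Fin n; parallel edges and loops are
-- allowed.  The pair `ends e` is unordered: its order only serves as the
-- reference direction for orientations.

record Graph (n : ℕ) : Set where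
  field
    ∣E∣  : ℕ
    ends : Fin ∣E∣ → Fin n × Fin n

record Digraph (n : ℕ) : Set where
  field
    ∣A∣  : ℕ
    tail : Fin ∣A∣ → Fin n
    head : Fin ∣A∣ → Fin n

Orientation : ∀ {n} → Graph n → Set
Orientation G = Vec Bool (Graph.∣E∣ G)

orient : ∀ {n} (G : Graph n) → Orientation G → Digraph n
orient G o = record
  { ∣A∣  = ∣E∣
  ; tail = λ e → proj₁ (arc e)
  ; head = λ e → proj₂ (arc e)
  }
  where
  open Graph G
  arc : Fin ∣E∣ → Fin _ × Fin _
  arc e = if lookup o e then ends e else swap (ends e)

i : ∀ {n} → Graph n → Subset n → ℕ
i G Y = ∣ tabulate (λ e → does ((proj₁ (ends e) ∈? Y) ×-dec (proj₂ (ends e) ∈? Y))) ∣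
  where open Graph G

ϱ : ∀ {n} → Digraph n → Fin n → ℕ
ϱ D v = ∣ tabulate (λ a → does (head a ≟ᶠ v)) ∣
  where open Digraph D

module _ {n : ℕ} (D : Digraph n) where
  open Digraph D

  data Walk : Fin n → Fin n → Set where
    stop : ∀ {v} → Walk v v
    step : ∀ {s t} (a : Fin ∣A∣) → tail a ≡ s → Walk (head a) t → Walk s t

  arcs : ∀ {s t} → Walk s t → List (Fin ∣A∣)
  arcs stop         = []ˡ
  arcs (step a _ w) = a ∷ˡ arcs w

  nodes : ∀ {s t} → Walk s t → List (Fin n)
  nodes {s} stop         = s ∷ˡ []ˡ
  nodes {s} (step _ _ w) = s ∷ˡ nodes w

  Path : Fin n → Fin n → Set
  Path s t = Σ (Walk s t) λ w → Unique (nodes w)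

  LocallyEdgeConnected : ℕ → Subset n → Set
  LocallyEdgeConnected k S =
    ∀ s t → s ∈ S → t ∈ S → s ≢ t →
    Σ (Fin k → Path s t) λ P →
      ∀ a b → a ≢ b → Disjoint (arcs (proj₁ (P a))) (arcs (proj₁ (P b)))

-- ℤ^ S is the set of integral vectors indexed by S.  Membership proofs are
-- irrelevant, so that a vector has exactly one value at each element of S.

ℤ^ : ∀ {n} → Subset n → Set
ℤ^ S = ∀ v → .(v ∈ S) → ℤ

extend₀ : ∀ {n} {S : Subset n} → ℤ^ S → Fin n → ℤ
extend₀ {S = S} x v with v ∈? S
... | yes v∈S = x v v∈S
... | no  _   = 0ℤ

join : ∀ {n} {S : Subset n} → ℤ^ S → ℤ^ (∁ S) → Fin n → ℤ
join {S = S} x y v with v ∈? S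
... | yes v∈S = x v v∈S
... | no  v∉S = y v (x∉p⇒x∈∁p v∉S)

-- sumOver x Z is x̃(Z).

sumOver : ∀ {n} → (Fin n → ℤ) → Subset n → ℤ
sumOver x Z = sumIn +-0-commutativeMonoid (λ v → if lookup Z v then x v else 0ℤ)

-- Set functions take values in ℤ ∪ {-∞}, with ⊥₋ as -∞.

infixl 6 _+₋_

_+₋_ : ℤ ₋ → ℤ ₋ → ℤ ₋
[ a ] +₋ [ b ] = [ a + b ]
[ _ ] +₋ ⊥₋    = ⊥₋
⊥₋    +₋ _     = ⊥₋

Supermodular : ∀ {n} → (Subset n → ℤ ₋) → Set
Supermodular p = ∀ X Y → (p X +₋ p Y) ≤₋ (p (X ∩ Y) +₋ p (X ∪ Y))

-- The integral points of { x ∈ ℝ^T : x̃(T) = h(T), x̃(Z) ≥ h(Z) for all Z ⊂ T }.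
-- Only the coordinates of x in T and the values of h on subsets of T matter.

IntegralBase : ∀ {n} (T : Subset n) → (Subset n → ℤ ₋) → (Fin n → ℤ) → Set
IntegralBase T h x =
  [ sumOver x T ] ≡ h T × (∀ Z → Z ⊂ T → h Z ≤₋ [ sumOver x Z ])

-- An integral base-polyhedron is the polyhedron of a (fully) supermodular
-- integer-valued p with p(∅) = 0 and p(V) finite; by the usual convention the
-- empty set is a base-polyhedron as well.

MConvex : ∀ {n} → ((Fin n → ℤ) → Set) → Set
MConvex {n} B =
  (∀ x → ¬ B x)
  ⊎ (Σ (Subset n → ℤ ₋) λ p →
       Supermodular p × p ∅ ≡ [ 0ℤ ] × p full ≢ ⊥₋ ×
       (∀ x → B x ⇔ IntegralBase full p x))

-- max⊆ T f is the maximum of f X over all X ⊆ T.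

max⊆ : ∀ {n} → Subset n → (Subset n → ℤ) → ℤ
max⊆ []            f = f []
max⊆ (outside ∷ T) f = max⊆ T (λ X → f (outside ∷ X))
max⊆ (inside  ∷ T) f =
  max⊆ T (λ X → f (outside ∷ X)) ⊔ max⊆ T (λ X → f (inside ∷ X))

module _ {n : ℕ} (G : Graph n) (S : Subset n) (m : ℤ^ (∁ S)) where
  open Graph G

  -- For S = ∅ the prescriptions for h(∅) and h(S) overlap and the former is
  -- used; they agree whenever m is realizable in the sense below.

  h : ℕ → Subset n → ℤ ₋
  h k Z with ≡-dec _≟ᵇ_ Z ∅ | ≡-dec _≟ᵇ_ Z S
  ... | yes _ | _     = [ 0ℤ ]
  ... | no  _ | yes _ = [ + ∣E∣ - sumOver (extend₀ m) (∁ S) ]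
  ... | no  _ | no  _ =
    [ max⊆ (∁ S) (λ X → + k + + i G (Z ∪ X) - sumOver (extend₀ m) X) ]

  B : ℕ → ℤ^ S → Set
  B k x = IntegralBase S (h k) (extend₀ x)

  MeetsSpec : Digraph n → Set
  MeetsSpec D = ∀ v (v∉S : v ∈ ∁ S) → + ϱ D v ≡ m v v∉S

  -- The constraints defining B do not force i(X) ≤ m̃(X), or m̃(X) at most the
  -- number of edges meeting X, for X ⊆ V - S.  Without them B can have integral
  -- points although no orientation has in-degrees m on V - S: take S = {s , t}
  -- with three parallel st-edges, an isolated node u with m(u) = 1, and k = 1.

  Realizable : Set
  Realizable = ∃ λ (o : Orientation G) → MeetsSpec (orient G o)

  InDegreeVector : ℕ → (Fin n → ℤ) → Set
  InDegreeVector k y = ∃ λ (o : Orientation G) → let D = orient G o in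
    LocallyEdgeConnected D k S × MeetsSpec D × (∀ v → y v ≡ + ϱ D v)

  JoinedBase : ℕ → (Fin n → ℤ) → Set
  JoinedBase k y = Σ (ℤ^ S) λ mS → B k mS × (∀ v → y v ≡ join mS m v)

{-# OPTIONS --safe #-}

-- A vector y is an in-degree vector of the required kind iff y(V) = |E|,
-- y(X) ≥ i(X) for all X, y(X) ≥ i(X) + k for all X splitting S, and y = m off S
-- ("feasible").  This follows from Hakimi's theorem (y is an in-degree vector iff
-- y(V) = |E| and y(X) ≥ i(X) for all X) and Menger's theorem, which is itself
-- deduced from Hakimi's.  When m is realizable, the constraints for the sets not
-- splitting S hold automatically, and the others amount to membership in B_S.
--
-- For M-convexity, let p(Z) be the minimum of y(Z) over feasible y.  The feasible
-- vectors are the integral points of the polyhedron of p, and p is supermodular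
-- as soon as every chain X ∩ Y ⊆ X ∪ Y has a common minimiser.  Such a minimiser
-- results from the exchange property: if x, y are feasible and x(u) > y(u), then
-- x - e_u + e_v is feasible for some v with x(v) < y(v).
module Submission where

open import Defs
open import Algebra.Properties.AbelianGroup using ()
open import Algebra.Properties.CommutativeMonoid.Sum using ()
open import Data.Bool.Base using (Bool; true; false; if_then_else_; _∧_; _∨_; not)
open import Data.Bool.Properties using (∧-comm; ∧-identityʳ; ∨-zeroʳ) renaming (_≟_ to _≟ᵇ_)
open import Data.Fin.Base using (Fin; zero; suc)
open import Data.Fin.Properties using (_≟_; any?)
open import Data.Fin.Subset using (Subset; inside; outside; _∈_; _∉_; _⊆_; _⊂_; _∩_; _∪_; ∁; ∣_∣; ⁅_⁆) renaming (⊥ to ∅; ⊤ to full; _-_ to _∖_)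
open import Data.Fin.Subset.Properties
open import Data.Integer.Base using (ℤ; +_; 0ℤ; 1ℤ; -1ℤ; _+_; _-_; _*_; -_; _≤_; _<_; _⊔_; +≤+)
open import Data.Integer.Properties hiding (_≟_)
open import Data.Integer.Properties using () renaming (_≟_ to _≟ᶻ_)
open import Data.Integer.Solver using (module +-*-Solver)
open import Data.List.Membership.DecPropositional using () renaming (_∈?_ to member?)
open import Data.List.Membership.Propositional using () renaming (_∈_ to _∈ˡ_)
open import Data.List.Relation.Binary.Disjoint.Propositional using (Disjoint)
open import Data.List.Relation.Unary.All using () renaming ([] to []ᵃ)
open import Data.List.Relation.Unary.All.Properties using (¬Any⇒All¬)
open import Data.List.Relation.Unary.AllPairs using () renaming ([] to []ᵖ; _∷_ to _∷ᵖ_)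
open import Data.List.Relation.Unary.Any using (here; there)
open import Data.List.Relation.Unary.Unique.Propositional using (Unique)
open import Data.Nat.Base as ℕ using (ℕ; zero; suc)
import Data.Nat.Properties as ℕₚ
open import Data.Product.Base using (Σ; ∃; _×_; _,_; proj₁; proj₂)
open import Data.Sum.Base using (_⊎_; inj₁; inj₂)
open import Data.Vec.Base using ([]; _∷_; lookup; tabulate; replicate) renaming (here to hereᵛ)
open import Data.Vec.Properties using (≡-dec; lookup-zipWith; lookup-map; lookup-replicate; []=⇒lookup; lookup⇒[]=; lookup∘tabulate)
open import Function.Base using (_∘_)
open import Function.Bundles using (_⇔_; mk⇔)
open import Relation.Binary.Construct.Add.Infimum.NonStrict _≤_ using ([≤]-injective) renaming ([_] to [_]≤)
open import Relation.Binary.PropositionalEquality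
open import Relation.Nullary.Construct.Add.Infimum using (_₋; [_]; []-injective)
open import Relation.Nullary.Decidable using (Dec; yes; no; does; ¬?; _×-dec_; dec-true; dec-false; decidable-stable)
open import Relation.Nullary.Negation.Core using (¬_; contradiction)

open Algebra.Properties.AbelianGroup +-0-abelianGroup using (∙-cancelʳ)
open Algebra.Properties.CommutativeMonoid.Sum +-0-commutativeMonoid using (sum; ∑-distrib-+; ∑-comm; sum-cong-≗; sum-replicate-zero)
open +-*-Solver using (solve; con; _:+_; _:*_; :-_; _:-_; _:=_)

-- Inequalities, indicator sums and sums over node sets.

-- The equation says `b - a ≡ d - c`, written without subtraction. Linear inequalities are obtained
-- from it throughout: `a ≤ b` is a hypothesis or a sum of hypotheses, and the equation goes to the
-- ring solver.
≤-shift : ∀ {a b c d} → a ≤ b → b + c ≡ d + a → c ≤ d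
≤-shift {a} {b} {c} {d} a≤b eq = 0≤i-j⇒j≤i (subst (0ℤ ≤_) difference (i≤j⇒0≤j-i a≤b))
  where
  open ≡-Reasoning
  difference : b - a ≡ d - c
  difference = begin
    b - a              ≡⟨ solve 3 (λ a b c → b :- a := b :+ c :- (a :+ c)) refl a b c ⟩
    b + c - (a + c)    ≡⟨ cong (_- (a + c)) eq ⟩
    d + a - (a + c)    ≡⟨ solve 3 (λ a c d → d :+ a :- (a :+ c) := d :- c) refl a c d ⟩
    d - c              ∎

1≰0 : ¬ (1ℤ ≤ 0ℤ)
1≰0 (+≤+ ())

⟦_⟧ : Bool → ℤ
⟦ b ⟧ = if b then 1ℤ else 0ℤ

0≤⟦_⟧ : ∀ b → 0ℤ ≤ ⟦ b ⟧
0≤⟦ true ⟧ = +≤+ ℕ.z≤n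
0≤⟦ false ⟧ = +≤+ ℕ.z≤n

δ : ∀ {n} → Fin n → Fin n → ℤ
δ u v = ⟦ does (u ≟ v) ⟧

sum-mono : ∀ {n} {f g : Fin n → ℤ} → (∀ v → f v ≤ g v) → sum f ≤ sum g
sum-mono {zero}  f≤g = ≤-refl
sum-mono {suc n} f≤g = +-mono-≤ (f≤g zero) (sum-mono (f≤g ∘ suc))

sum-mono-< : ∀ {n} {f g : Fin n → ℤ} → (∀ v → f v ≤ g v) → ∀ u → f u < g u → sum f < sum g
sum-mono-< f≤g zero    fu<gu = +-mono-<-≤ fu<gu (sum-mono (f≤g ∘ suc))
sum-mono-< f≤g (suc u) fu<gu = +-mono-≤-< (f≤g zero) (sum-mono-< (f≤g ∘ suc) u fu<gu)

sum-zero : ∀ {n} {f : Fin n → ℤ} → (∀ v → f v ≡ 0ℤ) → sum f ≡ 0ℤ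
sum-zero {n} f≡0 = trans (sum-cong-≗ f≡0) (sum-replicate-zero n)

sum-+ : ∀ {n} {f g h : Fin n → ℤ} → (∀ v → f v ≡ g v + h v) → sum f ≡ sum g + sum h
sum-+ {n} {f} {g} {h} eq = trans (sum-cong-≗ {n} eq) (∑-distrib-+ {n} g h)

sum-δ : ∀ {n} (u : Fin n) (f : Fin n → ℤ) →
        sum (λ v → if does (u ≟ v) then f v else 0ℤ) ≡ f u
sum-δ {suc n} zero f = trans (cong (_+_ (f zero)) (sum-replicate-zero n)) (+-identityʳ _)
sum-δ (suc u) f = trans (+-identityˡ _) (sum-δ u (f ∘ suc))

sum-∣∣ : ∀ {n} (b : Fin n → Bool) → + ∣ tabulate b ∣ ≡ sum (λ a → ⟦ b a ⟧)
sum-∣∣ {zero}  b = refl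
sum-∣∣ {suc n} b with b zero
... | true  = cong (_+_ 1ℤ) (sum-∣∣ (b ∘ suc))
... | false = trans (sum-∣∣ (b ∘ suc)) (sym (+-identityˡ _))

∈?-lookup : ∀ {n} (v : Fin n) X → does (v ∈? X) ≡ lookup X v
∈?-lookup zero    (true  ∷ X) = refl
∈?-lookup zero    (false ∷ X) = refl
∈?-lookup (suc v) (_     ∷ X) = ∈?-lookup v X

lookup-⁅⁆ : ∀ {n} (u v : Fin n) → lookup ⁅ u ⁆ v ≡ does (u ≟ v)
lookup-⁅⁆ zero    zero    = refl
lookup-⁅⁆ zero    (suc v) = lookup-replicate v false
lookup-⁅⁆ (suc u) zero    = refl
lookup-⁅⁆ (suc u) (suc v) = lookup-⁅⁆ u v

∉⇒lookup : ∀ {n} {v : Fin n} {X} → v ∉ X → lookup X v ≡ false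
∉⇒lookup {v = v} {X} v∉X with lookup X v in eq
... | true  = contradiction (lookup⇒[]= v X eq) v∉X
... | false = refl

lookup⇒∉ : ∀ {n} {v : Fin n} {X} → lookup X v ≡ false → v ∉ X
lookup⇒∉ eq v∈X with trans (sym eq) ([]=⇒lookup v∈X)
... | ()

sumOver-cong : ∀ {n} {x y : Fin n → ℤ} X → (∀ v → v ∈ X → x v ≡ y v) → sumOver x X ≡ sumOver y X
sumOver-cong {x = x} {y} X eq = sum-cong-≗ pointwise
  where
  pointwise : ∀ v → (if lookup X v then x v else 0ℤ) ≡ (if lookup X v then y v else 0ℤ)
  pointwise v with lookup X v in v∈X
  ... | true  = eq v (lookup⇒[]= v X v∈X)
  ... | false = refl

sumOver-∅ : ∀ {n} (x : Fin n → ℤ) → sumOver x ∅ ≡ 0ℤ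
sumOver-∅ x = sum-zero λ v → cong (if_then x v else 0ℤ) (lookup-replicate v false)

sumOver-⁅⁆ : ∀ {n} (x : Fin n → ℤ) v → sumOver x ⁅ v ⁆ ≡ x v
sumOver-⁅⁆ x v = trans (sum-cong-≗ λ w → cong (if_then x w else 0ℤ) (lookup-⁅⁆ v w)) (sum-δ v x)

sumOver-modular : ∀ {n} (x : Fin n → ℤ) X Y →
  sumOver x X + sumOver x Y ≡ sumOver x (X ∩ Y) + sumOver x (X ∪ Y)
sumOver-modular {n} x X Y = trans (sym (∑-distrib-+ {n} _ _)) (sum-+ {n} pointwise)
  where
  pointwise : ∀ v → (if lookup X v then x v else 0ℤ) + (if lookup Y v then x v else 0ℤ)
                  ≡ (if lookup (X ∩ Y) v then x v else 0ℤ) + (if lookup (X ∪ Y) v then x v else 0ℤ)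
  pointwise v rewrite lookup-zipWith _∧_ v X Y | lookup-zipWith _∨_ v X Y with lookup X v | lookup Y v
  ... | true  | true  = refl
  ... | true  | false = +-comm (x v) 0ℤ
  ... | false | true  = refl
  ... | false | false = refl

sumOver-∁ : ∀ {n} (x : Fin n → ℤ) X → sumOver x X + sumOver x (∁ X) ≡ sumOver x full
sumOver-∁ x X = begin
  sumOver x X + sumOver x (∁ X)                 ≡⟨ sumOver-modular x X (∁ X) ⟩
  sumOver x (X ∩ ∁ X) + sumOver x (X ∪ ∁ X)     ≡⟨ cong₂ (λ Y Z → sumOver x Y + sumOver x Z) (∩-inverseʳ X) (∪-inverseʳ X) ⟩
  sumOver x ∅ + sumOver x full                  ≡⟨ cong (_+ sumOver x full) (sumOver-∅ x) ⟩
  0ℤ + sumOver x full                           ≡⟨ +-identityˡ _ ⟩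
  sumOver x full                                ∎
  where open ≡-Reasoning

bump : ∀ {n} → Fin n → ℤ → (Fin n → ℤ) → Fin n → ℤ
bump u c x v = x v + c * δ u v

sumOver-bump : ∀ {n} u c (x : Fin n → ℤ) X →
  sumOver (bump u c x) X ≡ sumOver x X + c * ⟦ lookup X u ⟧
sumOver-bump u c x X = begin
  sumOver (bump u c x) X ≡⟨ sum-+ pointwise ⟩
  sumOver x X + sum (λ v → if does (u ≟ v) then c * ⟦ lookup X v ⟧ else 0ℤ)
    ≡⟨ cong (λ z → sumOver x X + z) (sum-δ u (λ v → c * ⟦ lookup X v ⟧)) ⟩
  sumOver x X + c * ⟦ lookup X u ⟧ ∎
  where
  open ≡-Reasoning
  pointwise : ∀ v → (if lookup X v then bump u c x v else 0ℤ) ≡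
    (if lookup X v then x v else 0ℤ) + (if does (u ≟ v) then c * ⟦ lookup X v ⟧ else 0ℤ)
  pointwise v with lookup X v | does (u ≟ v)
  ... | true  | true  = refl
  ... | true  | false = cong (_+_ (x v)) (*-zeroʳ c)
  ... | false | true  = sym (trans (+-identityˡ _) (*-zeroʳ c))
  ... | false | false = refl

-- Induced edges, in-degrees and entering arcs.

module _ {n : ℕ} (G : Graph n) where
  open Graph G

  -- The integer form of `i`, written as a sum of indicators so that inequalities can be checked
  -- edge by edge.
  induced : Subset n → ℤ
  induced X = sum (λ e → ⟦ lookup X (proj₁ (ends e)) ∧ lookup X (proj₂ (ends e)) ⟧)

  i≡induced : ∀ X → + i G X ≡ induced X
  i≡induced X = trans (sum-∣∣ {∣E∣} _) (sum-cong-≗ {∣E∣} λ e →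
    cong ⟦_⟧ (cong₂ _∧_ (∈?-lookup (proj₁ (ends e)) X) (∈?-lookup (proj₂ (ends e)) X)))

  -- An edge counts equally on both sides, unless it joins X - Y to Y - X: then it counts only in X
  -- ∪ Y.
  induced-supermodular : ∀ X Y → induced X + induced Y ≤ induced (X ∩ Y) + induced (X ∪ Y)
  induced-supermodular X Y = subst₂ _≤_ (∑-distrib-+ {∣E∣} _ _) (∑-distrib-+ {∣E∣} _ _)
    (sum-mono λ e → pointwise (proj₁ (ends e)) (proj₂ (ends e)))
    where
    booleans : ∀ a b c d → ⟦ a ∧ b ⟧ + ⟦ c ∧ d ⟧ ≤ ⟦ (a ∧ c) ∧ (b ∧ d) ⟧ + ⟦ (a ∨ c) ∧ (b ∨ d) ⟧
    booleans true  true  true  true  = ≤-refl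
    booleans true  true  true  false = ≤-refl
    booleans true  true  false true  = ≤-refl
    booleans true  true  false false = ≤-refl
    booleans true  false true  true  = ≤-refl
    booleans true  false true  false = ≤-refl
    booleans true  false false true  = +≤+ ℕ.z≤n
    booleans true  false false false = ≤-refl
    booleans false true  true  true  = ≤-refl
    booleans false true  true  false = +≤+ ℕ.z≤n
    booleans false true  false true  = ≤-refl
    booleans false true  false false = ≤-refl
    booleans false false true  true  = ≤-refl
    booleans false false true  false = ≤-refl
    booleans false false false true  = ≤-refl
    booleans false false false false = ≤-refl
    pointwise : ∀ a b → ⟦ lookup X a ∧ lookup X b ⟧ + ⟦ lookup Y a ∧ lookup Y b ⟧ ≤
      ⟦ lookup (X ∩ Y) a ∧ lookup (X ∩ Y) b ⟧ + ⟦ lookup (X ∪ Y) a ∧ lookup (X ∪ Y) b ⟧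
    pointwise a b rewrite lookup-zipWith _∧_ a X Y | lookup-zipWith _∨_ a X Y
                        | lookup-zipWith _∧_ b X Y | lookup-zipWith _∨_ b X Y =
      booleans (lookup X a) (lookup X b) (lookup Y a) (lookup Y b)

module _ {n : ℕ} (D : Digraph n) where
  open Digraph D

  indegree : Fin n → ℤ
  indegree v = sum (λ a → δ (head a) v)

  ϱ≡indegree : ∀ v → + ϱ D v ≡ indegree v
  ϱ≡indegree v = sum-∣∣ {∣A∣} _

  entering : Subset n → ℤ
  entering X = sum (λ a → ⟦ not (lookup X (tail a)) ∧ lookup X (head a) ⟧)

  sumOver-indegree : ∀ X → sumOver indegree X ≡ sum (λ a → ⟦ lookup X (head a) ⟧)
  sumOver-indegree X = begin
    sumOver indegree X ≡⟨ sum-cong-≗ pull ⟩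
    sum (λ v → sum (λ a → if lookup X v then δ (head a) v else 0ℤ)) ≡⟨ ∑-comm {n} {∣A∣} _ ⟩
    sum (λ a → sumOver (δ (head a)) X)
      ≡⟨ sum-cong-≗ (λ a → trans (sum-cong-≗ (flip-if a)) (sum-δ (head a) (λ v → ⟦ lookup X v ⟧))) ⟩
    sum (λ a → ⟦ lookup X (head a) ⟧) ∎
    where
    open ≡-Reasoning
    pull : ∀ v → (if lookup X v then indegree v else 0ℤ) ≡ sum (λ a → if lookup X v then δ (head a) v else 0ℤ)
    pull v with lookup X v
    ... | true  = refl
    ... | false = sym (sum-replicate-zero ∣A∣)
    flip-if : ∀ a v → (if lookup X v then δ (head a) v else 0ℤ) ≡ (if does (head a ≟ v) then ⟦ lookup X v ⟧ else 0ℤ)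
    flip-if a v with lookup X v | does (head a ≟ v)
    ... | true  | true  = refl
    ... | true  | false = refl
    ... | false | true  = refl
    ... | false | false = refl

module _ {n : ℕ} (G : Graph n) (o : Orientation G) where
  open Graph G
  private D = orient G o

  -- An arc with head in X is an induced edge or enters X, according to where its tail lies.
  sumOver-indegree-orient : ∀ X → sumOver (indegree D) X ≡ induced G X + entering D X
  sumOver-indegree-orient X = begin
    sumOver (indegree D) X ≡⟨ sumOver-indegree D X ⟩
    sum (λ e → ⟦ lookup X (Digraph.head D e) ⟧) ≡⟨ sum-+ pointwise ⟩
    induced G X + entering D X ∎
    where
    open ≡-Reasoning
    pointwise : ∀ e → ⟦ lookup X (Digraph.head D e) ⟧ ≡
      ⟦ lookup X (proj₁ (ends e)) ∧ lookup X (proj₂ (ends e)) ⟧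
      + ⟦ not (lookup X (Digraph.tail D e)) ∧ lookup X (Digraph.head D e) ⟧
    pointwise e with lookup o e
    ... | true with lookup X (proj₁ (ends e)) | lookup X (proj₂ (ends e))
    ...   | true  | true  = refl
    ...   | true  | false = refl
    ...   | false | true  = refl
    ...   | false | false = refl
    pointwise e | false with lookup X (proj₁ (ends e)) | lookup X (proj₂ (ends e))
    ...   | true  | true  = refl
    ...   | true  | false = refl
    ...   | false | true  = refl
    ...   | false | false = refl

  entering≥0 : ∀ X → 0ℤ ≤ entering D X
  entering≥0 X = subst (_≤ entering D X) (sum-replicate-zero ∣E∣) (sum-mono {∣E∣} λ e → 0≤⟦ _ ⟧)

  indegree-covers : ∀ X → induced G X ≤ sumOver (indegree D) X
  indegree-covers X = ≤-shift (entering≥0 X)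
    (trans (solve 2 (λ e i → e :+ i := i :+ e :+ con 0ℤ) refl (entering D X) (induced G X))
      (cong (_+ 0ℤ) (sym (sumOver-indegree-orient X))))

  sum-indegree : sumOver (indegree D) full ≡ + ∣E∣
  sum-indegree = trans (sumOver-indegree D full)
    (trans (sum-cong-≗ {∣E∣} λ e → cong ⟦_⟧ (lookup-replicate (Digraph.head D e) true)) (count ∣E∣))
    where
    count : ∀ m → sum {m} (λ _ → 1ℤ) ≡ + m
    count zero    = refl
    count (suc m) = cong (_+_ 1ℤ) (count m)

-- Hakimi's orientation theorem.

-- p and q tell whether X contains the two ends of an edge, I is i(X) without that
-- edge, and s is y(X).
blocked : ∀ p q (I s : ℤ) → ⟦ p ∧ q ⟧ + I ≤ s → ¬ (I ≤ s + -1ℤ * ⟦ p ⟧) → p ≡ true × q ≡ false × s ≤ I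
blocked false q I s I≤s ¬le = contradiction
  (≤-shift I≤s (solve 2 (λ I s → s :+ I := s :+ con -1ℤ :* con 0ℤ :+ (con 0ℤ :+ I)) refl I s)) ¬le
blocked true true I s I≤s ¬le = contradiction
  (≤-shift I≤s (solve 2 (λ I s → s :+ I := s :+ con -1ℤ :* con 1ℤ :+ (con 1ℤ :+ I)) refl I s)) ¬le
blocked true false I s I≤s ¬le = refl , refl ,
  ≤-shift (i<j⇒suc[i]≤j (≰⇒> ¬le)) (solve 2 (λ I s → I :+ s := I :+ (con 1ℤ :+ (s :+ con -1ℤ :* con 1ℤ))) refl I s)

-- Edges are oriented one at a time.  If neither direction of the edge ac is
-- feasible, there are tight sets X ∋ a, X ∌ c and Y ∋ c, Y ∌ a; as ac joins
-- X - Y to Y - X, supermodularity is strict at X , Y, a contradiction.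
hakimi : ∀ {n} (G : Graph n) (y : Fin n → ℤ) → sumOver y full ≡ + Graph.∣E∣ G →
         (∀ X → induced G X ≤ sumOver y X) →
         ∃ λ (o : Orientation G) → ∀ v → indegree (orient G o) v ≡ y v
hakimi {n} G = go (Graph.∣E∣ G) (Graph.ends G)
  where
  graph : ∀ E → (Fin E → Fin n × Fin n) → Graph n
  graph E ends = record { ∣E∣ = E ; ends = ends }

  go : ∀ E ends (y : Fin n → ℤ) → sumOver y full ≡ + E →
       (∀ X → induced (graph E ends) X ≤ sumOver y X) →
       ∃ λ (o : Orientation (graph E ends)) → ∀ v → indegree (orient (graph E ends) o) v ≡ y v
  -- Without edges every y(X) is at least 0 and the total is 0. So y(v) ≥ 0, and y(v) ≤ 0 follows
  -- from the complement of v.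
  go zero ends y total cover = [] , λ v → ≤-antisym
    (subst (0ℤ ≤_) (sumOver-⁅⁆ y v) (cover ⁅ v ⁆))
    (≤-shift (cover (∁ ⁅ v ⁆)) (begin
      sumOver y (∁ ⁅ v ⁆) + y v               ≡⟨ cong (_+_ (sumOver y (∁ ⁅ v ⁆))) (sumOver-⁅⁆ y v) ⟨
      sumOver y (∁ ⁅ v ⁆) + sumOver y ⁅ v ⁆   ≡⟨ +-comm (sumOver y (∁ ⁅ v ⁆)) _ ⟩
      sumOver y ⁅ v ⁆ + sumOver y (∁ ⁅ v ⁆)   ≡⟨ sumOver-∁ y ⁅ v ⁆ ⟩
      sumOver y full                          ≡⟨ total ⟩
      0ℤ                                      ∎))
    where open ≡-Reasoning
  go (suc E) ends y total cover = choose (anySubset? (bad? a)) (anySubset? (bad? c))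
    where
    a = proj₁ (ends zero)
    c = proj₂ (ends zero)
    H = graph E (ends ∘ suc)

    Bad : Fin n → Subset n → Set
    Bad w X = ¬ (induced H X ≤ sumOver (bump w -1ℤ y) X)

    bad? : ∀ w X → Dec (Bad w X)
    bad? w X = ¬? (induced H X ≤? sumOver (bump w -1ℤ y) X)

    -- Directing the edge towards `w` uses up one unit of y(w). The head of edge `zero` depends on
    -- the first entry alone; `replicate E b` is a filler that completes the orientation.
    extend : ∀ b w → w ≡ Digraph.head (orient (graph (suc E) ends) (b ∷ replicate E b)) zero → ¬ ∃ (Bad w) →
             ∃ λ (o : Orientation (graph (suc E) ends)) → ∀ v → indegree (orient (graph (suc E) ends) o) v ≡ y v
    extend b w refl good = b ∷ proj₁ rest , λ v → begin
      δ w v + indegree (orient H (proj₁ rest)) v ≡⟨ cong (_+_ (δ w v)) (proj₂ rest v) ⟩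
      δ w v + (y v + -1ℤ * δ w v)                ≡⟨ solve 2 (λ d y → d :+ (y :+ con -1ℤ :* d) := y) refl (δ w v) (y v) ⟩
      y v                                        ∎
      where
      open ≡-Reasoning
      total′ : sumOver (bump w -1ℤ y) full ≡ + E
      total′ = begin
        sumOver (bump w -1ℤ y) full                ≡⟨ sumOver-bump w -1ℤ y full ⟩
        sumOver y full + -1ℤ * ⟦ lookup full w ⟧   ≡⟨ cong₂ (λ s b → s + -1ℤ * ⟦ b ⟧) total (lookup-replicate w true) ⟩
        + E                                        ∎
      rest = go E (ends ∘ suc) (bump w -1ℤ y) total′ λ X →
        decidable-stable (induced H X ≤? sumOver (bump w -1ℤ y) X) λ bad → good (X , bad)

    conflict : ∃ (Bad a) → ¬ ∃ (Bad c)
    conflict (X , badX) (Y , badY)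
      with a∈X , c∉X , X-tight ← blocked (lookup X a) (lookup X c) (induced H X) (sumOver y X) (cover X)
             (subst (λ s → ¬ (induced H X ≤ s)) (sumOver-bump a -1ℤ y X) badX)
         | c∈Y , a∉Y , Y-tight ← blocked (lookup Y c) (lookup Y a) (induced H Y) (sumOver y Y)
             (subst (λ b → ⟦ b ⟧ + induced H Y ≤ sumOver y Y) (∧-comm (lookup Y a) (lookup Y c)) (cover Y))
             (subst (λ s → ¬ (induced H Y ≤ s)) (sumOver-bump c -1ℤ y Y) badY)
      = 1≰0 (≤-shift
          (+-mono-≤ (+-mono-≤ (+-mono-≤ X-tight Y-tight) (induced-supermodular H X Y)) (+-mono-≤ cover∩ cover∪))
          (trans (solve 6 (λ IX IY I∩ I∪ s∩ s∪ →
                     IX :+ IY :+ (I∩ :+ I∪) :+ (s∩ :+ s∪) :+ con 1ℤ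
                     := s∩ :+ s∪ :+ (IX :+ IY) :+ (con 0ℤ :+ I∩ :+ (con 1ℤ :+ I∪)))
                   refl (induced H X) (induced H Y) (induced H (X ∩ Y)) (induced H (X ∪ Y)) (sumOver y (X ∩ Y)) (sumOver y (X ∪ Y)))
            (trans (cong (λ z → z + (induced H X + induced H Y) + (0ℤ + induced H (X ∩ Y) + (1ℤ + induced H (X ∪ Y)))) (sym (sumOver-modular y X Y)))
             (sym (+-identityˡ _)))))
      where
      cover∩ : 0ℤ + induced H (X ∩ Y) ≤ sumOver y (X ∩ Y)
      cover∩ = ≤-trans (+-monoˡ-≤ (induced H (X ∩ Y)) 0≤⟦ lookup (X ∩ Y) a ∧ lookup (X ∩ Y) c ⟧) (cover (X ∩ Y))
      -- Supermodularity is applied in `H`, which lacks the edge ac. As a ∈ X and c ∈ Y, this edge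
      -- lies inside X ∪ Y and yields the extra 1 that makes the inequalities add up to 1 ≤ 0.
      cover∪ : 1ℤ + induced H (X ∪ Y) ≤ sumOver y (X ∪ Y)
      cover∪ = subst (λ b → ⟦ b ⟧ + induced H (X ∪ Y) ≤ sumOver y (X ∪ Y))
        (cong₂ _∧_ (trans (lookup-zipWith _∨_ a X Y) (cong (_∨ lookup Y a) a∈X))
                   (trans (lookup-zipWith _∨_ c X Y) (trans (cong (lookup X c ∨_) c∈Y) (∨-zeroʳ _))))
        (cover (X ∪ Y))

    choose : Dec (∃ (Bad a)) → Dec (∃ (Bad c)) → _
    choose (no good) _         = extend false a refl good
    choose (yes _)   (no good) = extend true c refl good
    choose (yes X)   (yes Y)   = contradiction Y (conflict X)

-- Menger's theorem.

injection-∣∣ : ∀ {n} k (f : Fin k → Fin n) (P : Subset n) → (∀ i → f i ∈ P) →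
               (∀ i j → i ≢ j → f i ≢ f j) → k ℕ.≤ ∣ P ∣
injection-∣∣ zero    f P f∈P inj = ℕ.z≤n
injection-∣∣ (suc k) f P f∈P inj = ℕₚ.≤-trans
  (ℕ.s≤s (injection-∣∣ k (f ∘ suc) (P ∖ f zero)
    (λ i → x∈p∧x≢y⇒x∈p-y (f∈P (suc i)) (inj (suc i) zero λ ()))
    (λ i j i≢j → inj (suc i) (suc j) λ { refl → i≢j refl })))
  (x∈p⇒∣p-x∣<∣p∣ (f∈P zero))

module _ {n : ℕ} (D : Digraph n) where
  open Digraph D

  crossing-arc : ∀ {s t} X (w : Walk D s t) → s ∉ X → t ∈ X →
    ∃ λ a → a ∈ˡ arcs D w × tail a ∉ X × head a ∈ X
  crossing-arc X stop s∉X t∈X = contradiction t∈X s∉X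
  crossing-arc X (step a refl w) s∉X t∈X with head a ∈? X
  ... | yes h∈X = a , here refl , s∉X , h∈X
  ... | no  h∉X with b , b∈w , b-crosses ← crossing-arc X w h∉X t∈X = b , there b∈w , b-crosses

  -- Each path has an arc entering X, and arc-disjointness makes these arcs distinct.
  paths⇒cut : ∀ {k s t} X (P : Fin k → Path D s t) →
    (∀ a b → a ≢ b → Disjoint (arcs D (proj₁ (P a))) (arcs D (proj₁ (P b)))) →
    s ∉ X → t ∈ X → + k ≤ entering D X
  paths⇒cut {k} X P disjoint s∉X t∈X = subst (+ k ≤_) (sum-∣∣ crosses)
    (+≤+ (injection-∣∣ k (proj₁ ∘ crossing) (tabulate crosses) member distinct))
    where
    crosses : Fin ∣A∣ → Bool
    crosses a = not (lookup X (tail a)) ∧ lookup X (head a)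
    crossing : ∀ i → _
    crossing i = crossing-arc X (proj₁ (P i)) s∉X t∈X
    member : ∀ i → proj₁ (crossing i) ∈ tabulate crosses
    member i with a , _ , t∉X , h∈X ← crossing i = lookup⇒[]= a _
      (trans (lookup∘tabulate crosses a) (cong₂ (λ p q → not p ∧ q) (∉⇒lookup t∉X) ([]=⇒lookup h∈X)))
    distinct : ∀ i j → i ≢ j → proj₁ (crossing i) ≢ proj₁ (crossing j)
    distinct i j i≢j eq = disjoint i j i≢j
      (proj₁ (proj₂ (crossing i)) , subst (_∈ˡ arcs D (proj₁ (P j))) (sym eq) (proj₁ (proj₂ (crossing j))))

  suffix : ∀ {s t v} (w : Walk D s t) → Unique (nodes D w) → v ∈ˡ nodes D w →
    ∃ λ (w′ : Walk D v t) → Unique (nodes D w′) × (∀ {a} → a ∈ˡ arcs D w′ → a ∈ˡ arcs D w)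
  suffix stop            unique        (here refl) = stop , unique , λ ()
  suffix (step a refl w) unique        (here refl) = step a refl w , unique , λ a∈w → a∈w
  suffix (step a refl w) (_ ∷ᵖ unique) (there v∈w)
    with w′ , unique′ , sub ← suffix w unique v∈w = w′ , unique′ , there ∘ sub

  -- Loop erasure: if `s` recurs in the shortened remainder, the suffix starting there is taken.
  -- Since only arcs of the original walk survive, disjointness of walks is inherited.
  shortcut : ∀ {s t} (w : Walk D s t) →
    ∃ λ (w′ : Walk D s t) → Unique (nodes D w′) × (∀ {a} → a ∈ˡ arcs D w′ → a ∈ˡ arcs D w)
  shortcut stop = stop , []ᵃ ∷ᵖ []ᵖ , λ ()
  shortcut {s} (step a refl w) with shortcut w
  ... | w′ , unique , sub with member? _≟_ s (nodes D w′)
  ...   | no  s∉w′ = step a refl w′ , ¬Any⇒All¬ _ s∉w′ ∷ᵖ unique ,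
                     λ { (here refl) → here refl ; (there b∈w′) → there (sub b∈w′) }
  ...   | yes s∈w′ with w″ , unique″ , sub″ ← suffix w′ unique s∈w′ =
                     w″ , unique″ , there ∘ sub ∘ sub″

  -- Out-degree minus in-degree within the arc set F. If it equals k at s, - k at t and 0 elsewhere,
  -- F is a 0-1 flow of value k.
  net : Subset ∣A∣ → Fin n → ℤ
  net F v = sumOver (λ a → δ (tail a) v - δ (head a) v) F

module _ {n : ℕ} where
  remove : Subset n → Fin n → Subset n
  remove F a = F ∩ ∁ ⁅ a ⁆

  remove-⊆ : ∀ {F a} → remove F a ⊆ F
  remove-⊆ {F} = proj₁ ∘ x∈p∩q⁻ F _

  ∉remove : ∀ {F a} → a ∉ remove F a
  ∉remove {F} {a} a∈F = x∈∁p⇒x∉p (proj₂ (x∈p∩q⁻ F _ a∈F)) (x∈⁅x⁆ a)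

  sumOver-remove : ∀ (x : Fin n → ℤ) {F a} → a ∈ F → sumOver x F ≡ x a + sumOver x (remove F a)
  sumOver-remove x {F} {a} a∈F = trans (sum-+ pointwise) (cong (_+ sumOver x (remove F a)) (sum-δ a x))
    where
    pointwise : ∀ b → (if lookup F b then x b else 0ℤ) ≡
      (if does (a ≟ b) then x b else 0ℤ) + (if lookup (remove F a) b then x b else 0ℤ)
    pointwise b rewrite lookup-zipWith _∧_ b F (∁ ⁅ a ⁆) | lookup-map b not ⁅ a ⁆ | lookup-⁅⁆ a b with a ≟ b
    ... | yes refl rewrite []=⇒lookup a∈F = sym (+-identityʳ (x b))
    ... | no  _    rewrite ∧-identityʳ (lookup F b) = sym (+-identityˡ _)

δ-refl : ∀ {n} (u : Fin n) → δ u u ≡ 1ℤ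
δ-refl u = cong ⟦_⟧ (dec-true (u ≟ u) refl)

δ-≢ : ∀ {n} {u v : Fin n} → u ≢ v → δ u v ≡ 0ℤ
δ-≢ {u = u} {v} u≢v = cong ⟦_⟧ (dec-false (u ≟ v) u≢v)

module _ {n : ℕ} (D : Digraph n) (s t : Fin n) where
  open Digraph D

  arc-out : ∀ {F c} → 1ℤ ≤ net D F c → ∃ λ a → a ∈ F × tail a ≡ c
  arc-out {F} {c} 1≤net with any? (λ a → (a ∈? F) ×-dec (tail a ≟ c))
  ... | yes found = found
  ... | no  none  = contradiction (≤-trans 1≤net (subst (net D F c ≤_) (sum-replicate-zero ∣A∣) (sum-mono {∣A∣} nonpos))) 1≰0
    where
    nonpos : ∀ a → (if lookup F a then δ (tail a) c - δ (head a) c else 0ℤ) ≤ 0ℤ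
    nonpos a with lookup F a in eq
    ... | false = ≤-refl
    ... | true rewrite δ-≢ (λ ta≡c → none (a , lookup⇒[]= a F eq , ta≡c)) =
      ≤-shift 0≤⟦ does (head a ≟ c) ⟧ (solve 1 (λ h → h :+ (con 0ℤ :- h) := con 0ℤ :+ con 0ℤ) refl (δ (head a) c))

  -- This keeps `trace` from getting stuck: short of t, the current node c has positive net outflow,
  -- and c = s only increases it. By `arc-out`, some arc then leaves c.
  1≤net : ∀ {c} → c ≢ t → ∀ j → 1ℤ ≤ + j * δ s c + δ c c - + suc j * δ t c
  1≤net {c} c≢t j rewrite δ-refl c | δ-≢ (c≢t ∘ sym) = ≤-shift (0≤j* (does (s ≟ c)))
    (solve 2 (λ x y → x :+ con 1ℤ := (x :+ con 1ℤ :- y :* con 0ℤ) :+ con 0ℤ) refl (+ j * δ s c) (+ suc j))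
    where
    0≤j* : ∀ b → 0ℤ ≤ + j * ⟦ b ⟧
    0≤j* true  = subst (0ℤ ≤_) (sym (*-identityʳ (+ j))) (+≤+ ℕ.z≤n)
    0≤j* false = ≤-reflexive (sym (*-zeroʳ (+ j)))

  -- Walking along `a` and deleting it replaces its tail by its head in the balance, so the
  -- invariant of `trace` keeps its shape at the new node. `p` and `q` stand for the terms at s and
  -- t.
  net-remove : ∀ {F a v} p q → a ∈ F → net D F v ≡ p + δ (tail a) v - q →
               net D (remove F a) v ≡ p + δ (head a) v - q
  net-remove {F} {a} {v} p q a∈F eq = begin
    net D (remove F a) v
      ≡⟨ solve 3 (λ h c r → r := (c :- h) :+ r :+ h :- c) refl (δ (head a) v) (δ (tail a) v) (net D (remove F a) v) ⟩
    δ (tail a) v - δ (head a) v + net D (remove F a) v + δ (head a) v - δ (tail a) v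
      ≡⟨ cong (λ z → z + δ (head a) v - δ (tail a) v) (trans (sym (sumOver-remove _ a∈F)) eq) ⟩
    p + δ (tail a) v - q + δ (head a) v - δ (tail a) v
      ≡⟨ solve 4 (λ x c y h → x :+ c :- y :+ h :- c := x :+ h :- y) refl p (δ (tail a) v) q (δ (head a) v) ⟩
    p + δ (head a) v - q ∎
    where open ≡-Reasoning

  Disjointly : ∀ {j} → Subset ∣A∣ → (Fin j → Walk D s t) → Set
  Disjointly F P = (∀ i {a} → a ∈ˡ arcs D (P i) → a ∈ F) ×
                   (∀ i j → i ≢ j → Disjoint (arcs D (P i)) (arcs D (P j)))

  -- In `trace` the first of the suc j walks has already come from s to c.
  trace : ∀ N j c F → ∣ F ∣ ℕ.≤ N →
    (∀ v → net D F v ≡ + j * δ s v + δ c v - + suc j * δ t v) →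
    ∃ λ (w : Walk D c t) → (∀ {a} → a ∈ˡ arcs D w → a ∈ F) ×
    ∃ λ (P : Fin j → Walk D s t) → Disjointly F P × (∀ i → Disjoint (arcs D w) (arcs D (P i)))
  -- Flow decomposition: walks from s to t are peeled off one by one and their arcs deleted. The
  -- mutual recursion is on `N`, a bound on the number of arcs left, and then on `j`.
  decompose : ∀ N j F → ∣ F ∣ ℕ.≤ N → (∀ v → net D F v ≡ + j * δ s v - + j * δ t v) →
    ∃ λ (P : Fin j → Walk D s t) → Disjointly F P

  trace N j c F size flow with c ≟ t
  ... | yes refl with P , P-disjoint ← decompose N j F size (λ v → trans (flow v)
          (solve 3 (λ j x y → j :* x :+ y :- (con 1ℤ :+ j) :* y := j :* x :- j :* y) refl (+ j) (δ s v) (δ t v))) =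
      stop , (λ ()) , P , P-disjoint , λ i ()
  trace N j c F size flow | no c≢t with arc-out {F} {c} (subst (1ℤ ≤_) (sym (flow c)) (1≤net c≢t j))
  trace zero j c F size flow | no c≢t | a , a∈F , refl =
    contradiction (ℕₚ.<-≤-trans (x∈p⇒∣p-x∣<∣p∣ a∈F) size) λ ()
  trace (suc N) j c F size flow | no c≢t | a , a∈F , refl
    with w , w⊆ , P , (P⊆ , P-disjoint) , w-disjoint ← trace N j (head a) (remove F a)
           (ℕ.s≤s⁻¹ (ℕₚ.<-≤-trans (p⊂q⇒∣p∣<∣q∣ (remove-⊆ , a , a∈F , ∉remove)) size))
           (λ v → net-remove (+ j * δ s v) (+ suc j * δ t v) a∈F (flow v)) =
    step a refl w ,
    (λ { (here refl) → a∈F ; (there b∈w) → remove-⊆ (w⊆ b∈w) }) ,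
    P , ((λ i b∈P → remove-⊆ (P⊆ i b∈P)) , P-disjoint) ,
    λ { i (here refl , a∈P) → ∉remove (P⊆ i a∈P) ; i (there b∈w , b∈P) → w-disjoint i (b∈w , b∈P) }

  decompose N zero    F size flow = (λ ()) , (λ ()) , (λ ())
  decompose N (suc j) F size flow
    with w , w⊆ , P , (P⊆ , P-disjoint) , w-disjoint ← trace N j s F size (λ v → trans (flow v)
           (solve 3 (λ j x y → (con 1ℤ :+ j) :* x :- (con 1ℤ :+ j) :* y := j :* x :+ x :- (con 1ℤ :+ j) :* y) refl (+ j) (δ s v) (δ t v))) =
    walks , walks⊆ , disjoint
    where
    walks : Fin (suc j) → Walk D s t
    walks zero    = w
    walks (suc i) = P i
    walks⊆ : ∀ i {a} → a ∈ˡ arcs D (walks i) → a ∈ F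
    walks⊆ zero    = w⊆
    walks⊆ (suc i) = P⊆ i
    disjoint : ∀ i j → i ≢ j → Disjoint (arcs D (walks i)) (arcs D (walks j))
    disjoint zero    zero    i≢j = contradiction refl i≢j
    disjoint zero    (suc j) _   = w-disjoint j
    disjoint (suc i) zero    _   (a∈P , a∈w) = w-disjoint i (a∈w , a∈P)
    disjoint (suc i) (suc j) i≢j = P-disjoint i j (i≢j ∘ cong suc)

-- Reversing k arc-disjoint st-paths changes the in-degrees by k at s and by - k
-- at t.  An orientation with these in-degrees exists, and the arcs on which it
-- differs from the given one form a flow of value k.
cut⇒paths : ∀ {n} (G : Graph n) (o : Orientation G) k s t →
  (∀ X → s ∉ X → t ∈ X → induced G X + + k ≤ sumOver (indegree (orient G o)) X) →
  Σ (Fin k → Path (orient G o) s t) λ P →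
    ∀ a b → a ≢ b → Disjoint (arcs (orient G o) (proj₁ (P a))) (arcs (orient G o) (proj₁ (P b)))
cut⇒paths {n} G o k s t cut = paths (decompose D s t _ k F (ℕₚ.≤-refl) flow)
  where
  open Graph G
  D = orient G o
  x = indegree D
  y = bump t (- + k) (bump s (+ k) x)

  sumOver-y : ∀ X → sumOver y X ≡ sumOver x X + + k * ⟦ lookup X s ⟧ + - + k * ⟦ lookup X t ⟧
  sumOver-y X = trans (sumOver-bump t (- + k) (bump s (+ k) x) X)
    (cong (_+ - + k * ⟦ lookup X t ⟧) (sumOver-bump s (+ k) x X))

  total : sumOver y full ≡ + ∣E∣
  total = begin
    sumOver y full ≡⟨ sumOver-y full ⟩
    sumOver x full + + k * ⟦ lookup full s ⟧ + - + k * ⟦ lookup full t ⟧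
      ≡⟨ cong₂ (λ p q → sumOver x full + + k * ⟦ p ⟧ + - + k * ⟦ q ⟧) (lookup-replicate s true) (lookup-replicate t true) ⟩
    sumOver x full + + k * 1ℤ + - + k * 1ℤ
      ≡⟨ solve 2 (λ x k → x :+ k :* con 1ℤ :+ (:- k) :* con 1ℤ := x) refl (sumOver x full) (+ k) ⟩
    sumOver x full ≡⟨ sum-indegree G o ⟩
    + ∣E∣ ∎
    where open ≡-Reasoning

  -- Passing from `x` to `y` loses k only on sets containing t but not s, and there `cut` provides a
  -- slack of k.
  covers : ∀ X → induced G X ≤ sumOver y X
  covers X rewrite sumOver-y X with lookup X s in s∈X | lookup X t in t∈X
  ... | true  | true  = ≤-shift (indegree-covers G o X)
    (solve 3 (λ i x k → x :+ i := x :+ k :* con 1ℤ :+ (:- k) :* con 1ℤ :+ i) refl (induced G X) (sumOver x X) (+ k))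
  ... | true  | false = ≤-shift (+-mono-≤ (indegree-covers G o X) (+≤+ (ℕ.z≤n {k})))
    (solve 3 (λ i x k → x :+ k :+ i := x :+ k :* con 1ℤ :+ (:- k) :* con 0ℤ :+ (i :+ con 0ℤ)) refl (induced G X) (sumOver x X) (+ k))
  ... | false | false = ≤-shift (indegree-covers G o X)
    (solve 3 (λ i x k → x :+ i := x :+ k :* con 0ℤ :+ (:- k) :* con 0ℤ :+ i) refl (induced G X) (sumOver x X) (+ k))
  ... | false | true  = ≤-shift (cut X (lookup⇒∉ s∈X) (lookup⇒[]= t X t∈X))
    (solve 3 (λ i x k → x :+ i := x :+ k :* con 0ℤ :+ (:- k) :* con 1ℤ :+ (i :+ k)) refl (induced G X) (sumOver x X) (+ k))

  reoriented = hakimi G y total covers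
  o′ = proj₁ reoriented
  D′ = orient G o′

  F : Subset ∣E∣
  F = tabulate λ e → not (does (lookup o e ≟ᵇ lookup o′ e))

  -- Reversing an arc moves one unit of in-degree from its head to its tail, so `net D F` is the
  -- difference of the in-degrees in `D′` and `D`.
  flow : ∀ v → net D F v ≡ + k * δ s v - + k * δ t v
  flow v = begin
    net D F v
      ≡⟨ solve 2 (λ f x → f := x :+ f :- x) refl (net D F v) (x v) ⟩
    x v + net D F v - x v
      ≡⟨ cong (_- x v) (sum-+ differ) ⟨
    indegree D′ v - x v
      ≡⟨ cong (_- x v) (proj₂ reoriented v) ⟩
    y v - x v
      ≡⟨ solve 4 (λ x k s t → x :+ k :* s :+ (:- k) :* t :- x := k :* s :- k :* t) refl (x v) (+ k) (δ s v) (δ t v) ⟩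
    + k * δ s v - + k * δ t v ∎
    where
    open ≡-Reasoning
    differ : ∀ e → δ (Digraph.head D′ e) v ≡ δ (Digraph.head D e) v +
      (if lookup F e then δ (Digraph.tail D e) v - δ (Digraph.head D e) v else 0ℤ)
    differ e rewrite lookup∘tabulate (λ e → not (does (lookup o e ≟ᵇ lookup o′ e))) e
      with lookup o e | lookup o′ e
    ... | true  | true  = sym (+-identityʳ _)
    ... | true  | false = solve 2 (λ p q → p := q :+ (p :- q)) refl (δ (proj₁ (ends e)) v) (δ (proj₂ (ends e)) v)
    ... | false | true  = solve 2 (λ p q → p := q :+ (p :- q)) refl (δ (proj₂ (ends e)) v) (δ (proj₁ (ends e)) v)
    ... | false | false = sym (+-identityʳ _)

  paths : (∃ λ (P : Fin k → Walk D s t) → Disjointly D s t F P) → _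
  paths (P , _ , disjoint) =
    (λ i → proj₁ (shortcut D (P i)) , proj₁ (proj₂ (shortcut D (P i)))) ,
    λ i j i≢j {_} (a∈i , a∈j) → disjoint i j i≢j
      (proj₂ (proj₂ (shortcut D (P i))) a∈i , proj₂ (proj₂ (shortcut D (P j))) a∈j)

-- Disjoint unions, maxima over subsets, and unit transfers.

sumOver-disjoint : ∀ {n} (x : Fin n → ℤ) {X Y} → (∀ {v} → v ∈ X → v ∉ Y) →
                   sumOver x (X ∪ Y) ≡ sumOver x X + sumOver x Y
sumOver-disjoint x {X} {Y} disjoint = begin
  sumOver x (X ∪ Y)                       ≡⟨ +-identityˡ _ ⟨
  0ℤ + sumOver x (X ∪ Y)                  ≡⟨ cong (_+ sumOver x (X ∪ Y)) (sumOver-∅ x) ⟨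
  sumOver x ∅ + sumOver x (X ∪ Y)         ≡⟨ cong (λ Z → sumOver x Z + sumOver x (X ∪ Y)) empty ⟨
  sumOver x (X ∩ Y) + sumOver x (X ∪ Y)   ≡⟨ sumOver-modular x X Y ⟨
  sumOver x X + sumOver x Y               ∎
  where
  open ≡-Reasoning
  empty : X ∩ Y ≡ ∅
  empty = Empty-unique λ (v , v∈) → disjoint (proj₁ (x∈p∩q⁻ X Y v∈)) (proj₂ (x∈p∩q⁻ X Y v∈))

sumOver-∁-cong : ∀ {n} (x y : Fin n → ℤ) {X} → sumOver x full ≡ sumOver y full →
                 sumOver x (∁ X) ≡ sumOver y (∁ X) → sumOver x X ≡ sumOver y X
sumOver-∁-cong x y {X} total eq = ∙-cancelʳ (sumOver x (∁ X)) _ _ (begin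
  sumOver x X + sumOver x (∁ X) ≡⟨ sumOver-∁ x X ⟩
  sumOver x full                ≡⟨ total ⟩
  sumOver y full                ≡⟨ sumOver-∁ y X ⟨
  sumOver y X + sumOver y (∁ X) ≡⟨ cong (_+_ (sumOver y X)) eq ⟨
  sumOver y X + sumOver x (∁ X) ∎)
  where open ≡-Reasoning

extend₀-∈ : ∀ {n} {T : Subset n} (x : ℤ^ T) {v} (v∈T : v ∈ T) → extend₀ x v ≡ x v v∈T
extend₀-∈ {T = T} x {v} v∈T with v ∈? T
... | yes _   = refl
... | no  v∉T = contradiction v∈T v∉T

max⊆-upper : ∀ {n} (T : Subset n) f {X} → X ⊆ T → f X ≤ max⊆ T f
max⊆-upper []            f {[]}          X⊆T = ≤-refl
max⊆-upper (outside ∷ T) f {outside ∷ X} X⊆T = max⊆-upper T _ (drop-∷-⊆ X⊆T)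
max⊆-upper (outside ∷ T) f {inside  ∷ X} X⊆T with () ← X⊆T hereᵛ
max⊆-upper (inside  ∷ T) f {outside ∷ X} X⊆T = i≤j⇒i≤j⊔k _ (max⊆-upper T _ (drop-∷-⊆ X⊆T))
max⊆-upper (inside  ∷ T) f {inside  ∷ X} X⊆T = i≤j⇒i≤k⊔j _ (max⊆-upper T _ (drop-∷-⊆ X⊆T))

max⊆-lub : ∀ {n} (T : Subset n) f {c} → (∀ X → X ⊆ T → f X ≤ c) → max⊆ T f ≤ c
max⊆-lub []            f bound = bound [] λ ()
max⊆-lub (outside ∷ T) f bound = max⊆-lub T _ λ X X⊆T → bound (outside ∷ X) (s⊆s X⊆T)
max⊆-lub (inside  ∷ T) f bound = ⊔-lub
  (max⊆-lub T _ λ X X⊆T → bound (outside ∷ X) (out⊆ X⊆T))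
  (max⊆-lub T _ λ X X⊆T → bound (inside ∷ X) (s⊆s X⊆T))

Splits : ∀ {n} → Subset n → Subset n → Set
Splits S X = (∃ λ t → t ∈ S × t ∈ X) × (∃ λ s → s ∈ S × s ∉ X)

splits? : ∀ {n} (S X : Subset n) → Dec (Splits S X)
splits? S X = any? (λ t → (t ∈? S) ×-dec (t ∈? X)) ×-dec any? (λ s → (s ∈? S) ×-dec ¬? (s ∈? X))

transfer : ∀ {n} → Fin n → Fin n → (Fin n → ℤ) → Fin n → ℤ
transfer u v x = bump v 1ℤ (bump u -1ℤ x)

sumOver-transfer : ∀ {n} u v (x : Fin n → ℤ) X →
  sumOver (transfer u v x) X ≡ sumOver x X + -1ℤ * ⟦ lookup X u ⟧ + 1ℤ * ⟦ lookup X v ⟧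
sumOver-transfer u v x X = trans (sumOver-bump v 1ℤ (bump u -1ℤ x) X)
  (cong (_+ 1ℤ * ⟦ lookup X v ⟧) (sumOver-bump u -1ℤ x X))

-- For d = x - y with x and y of equal total, this is half the l1-distance of x and y. It measures
-- progress in `common-minimiser`.
excess : ∀ {n} → (Fin n → ℤ) → ℤ
excess d = sum (λ v → d v ⊔ 0ℤ)

excess≥0 : ∀ {n} (d : Fin n → ℤ) → 0ℤ ≤ excess d
excess≥0 {n} d = subst (_≤ excess d) (sum-replicate-zero n) (sum-mono {n} λ v → i≤j⊔i (d v) 0ℤ)

-- The positive part drops by 1 at `u`. At `w` it stays 0, because d(w) ≤ -1 before the transfer.
excess-transfer : ∀ {n} {u w : Fin n} {d d′} → (∀ v → d′ v ≡ transfer u w d v) →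
  0ℤ < d u → d w < 0ℤ → excess d′ < excess d
excess-transfer {u = u} {w} {d} {d′} eq 0<du dw<0 = sum-mono-< weak u strict
  where
  u≢w : u ≢ w
  u≢w refl = <-asym 0<du dw<0

  at-u : d′ u ≡ d u + -1ℤ
  at-u rewrite eq u | δ-refl u | δ-≢ (u≢w ∘ sym) = solve 1 (λ d → d :+ con -1ℤ :* con 1ℤ :+ con 1ℤ :* con 0ℤ := d :+ con -1ℤ) refl (d u)

  0≤du-1 : 0ℤ ≤ d u + -1ℤ
  0≤du-1 = ≤-shift (i<j⇒suc[i]≤j 0<du) (solve 1 (λ d → d :+ con 0ℤ := d :+ con -1ℤ :+ con 1ℤ) refl (d u))

  strict : d′ u ⊔ 0ℤ < d u ⊔ 0ℤ
  strict rewrite at-u | i≥j⇒i⊔j≡i (<⇒≤ 0<du) | i≥j⇒i⊔j≡i 0≤du-1 = suc[i]≤j⇒i<j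
    (≤-reflexive (solve 1 (λ d → con 1ℤ :+ (d :+ con -1ℤ) := d) refl (d u)))

  weak : ∀ v → d′ v ⊔ 0ℤ ≤ d v ⊔ 0ℤ
  weak v with u ≟ v | w ≟ v
  ... | yes refl | _ = <⇒≤ strict
  ... | no u≢v | yes refl rewrite eq w | δ-≢ u≢v | δ-refl w = ⊔-lub
    (≤-trans (≤-shift (i<j⇒suc[i]≤j dw<0) (solve 1 (λ d → con 0ℤ :+ (d :+ con -1ℤ :* con 0ℤ :+ con 1ℤ :* con 1ℤ) := con 0ℤ :+ (con 1ℤ :+ d)) refl (d w)))
             (i≤j⊔i (d w) 0ℤ))
    (i≤j⊔i (d w) 0ℤ)
  ... | no u≢v | no w≢v rewrite eq v | δ-≢ u≢v | δ-≢ w≢v =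
    ≤-reflexive (cong (_⊔ 0ℤ) (solve 1 (λ d → d :+ con -1ℤ :* con 0ℤ :+ con 1ℤ :* con 0ℤ := d) refl (d v)))

i<j⇒0<j-i : ∀ {i j} → i < j → 0ℤ < j - i
i<j⇒0<j-i {i} {j} i<j = suc[i]≤j⇒i<j (≤-shift (i<j⇒suc[i]≤j i<j)
  (solve 2 (λ i j → j :+ con 1ℤ := j :- i :+ (con 1ℤ :+ i)) refl i j))

i<j⇒i-j<0 : ∀ {i j} → i < j → i - j < 0ℤ
i<j⇒i-j<0 {i} {j} i<j = suc[i]≤j⇒i<j (≤-shift (i<j⇒suc[i]≤j i<j)
  (solve 2 (λ i j → j :+ (con 1ℤ :+ (i :- j)) := con 0ℤ :+ (con 1ℤ :+ i)) refl i j))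

-- Feasible vectors as in-degree vectors.

module _ {n : ℕ} (G : Graph n) (S : Subset n) (m : ℤ^ (∁ S)) (k : ℕ) where
  open Graph G

  record Feasible (y : Fin n → ℤ) : Set where
    field
      total  : sumOver y full ≡ + ∣E∣
      covers : ∀ X → induced G X ≤ sumOver y X
      splits : ∀ X → Splits S X → induced G X + + k ≤ sumOver y X
      spec   : ∀ v → v ∈ ∁ S → y v ≡ extend₀ m v
  open Feasible

  feasible-resp : ∀ {x y} → (∀ v → x v ≡ y v) → Feasible x → Feasible y
  feasible-resp {x} {y} x≡y fx = record
    { total  = trans (sym (same full)) (total fx)
    ; covers = λ X → subst (induced G X ≤_) (same X) (covers fx X)
    ; splits = λ X X-splits → subst (induced G X + + k ≤_) (same X) (splits fx X X-splits)
    ; spec   = λ v v∉S → trans (sym (x≡y v)) (spec fx v v∉S)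
    }
    where
    same : ∀ X → sumOver x X ≡ sumOver y X
    same X = sumOver-cong X λ v _ → x≡y v

  indegree-spec : ∀ o → MeetsSpec G S m (orient G o) → ∀ v → v ∈ ∁ S → indegree (orient G o) v ≡ extend₀ m v
  indegree-spec o meets v v∉S =
    trans (sym (ϱ≡indegree (orient G o) v)) (trans (meets v v∉S) (sym (extend₀-∈ m v∉S)))

  -- Hakimi's theorem gives the orientation. For s and t in S, every set containing t but not s
  -- splits S, so `splits` is the cut condition that `cut⇒paths` asks for.
  feasible⇒inDegreeVector : ∀ {y} → Feasible y → InDegreeVector G S m k y
  feasible⇒inDegreeVector {y} fy with hakimi G y (total fy) (covers fy)
  ... | o , indegree≡y =
    o ,
    (λ s t s∈S t∈S s≢t → cut⇒paths G o k s t λ X s∉X t∈X →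
      splits (feasible-resp (sym ∘ indegree≡y) fy) X ((t , t∈S , t∈X) , (s , s∈S , s∉X))) ,
    (λ v v∉S → trans (ϱ≡indegree (orient G o) v) (trans (indegree≡y v) (trans (spec fy v v∉S) (extend₀-∈ m v∉S)))) ,
    λ v → trans (sym (indegree≡y v)) (sym (ϱ≡indegree (orient G o) v))

  inDegreeVector⇒feasible : ∀ {y} → InDegreeVector G S m k y → Feasible y
  inDegreeVector⇒feasible (o , connected , meets , y≡ϱ) =
    feasible-resp (λ v → sym (trans (y≡ϱ v) (ϱ≡indegree (orient G o) v))) record
      { total  = sum-indegree G o
      ; covers = indegree-covers G o
      ; splits = λ X ((t , t∈S , t∈X) , (s , s∈S , s∉X)) →
          let P , disjoint = connected s t s∈S t∈S λ { refl → s∉X t∈X } in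
          subst (induced G X + + k ≤_) (sym (sumOver-indegree-orient G o X))
            (+-monoʳ-≤ (induced G X) (paths⇒cut (orient G o) X P disjoint s∉X t∈X))
      ; spec   = indegree-spec o meets
      }

  -- Feasible vectors and the base B_S.

  h-∅ : h G S m k ∅ ≡ [ 0ℤ ]
  h-∅ with ≡-dec _≟ᵇ_ (∅ {n}) ∅ | ≡-dec _≟ᵇ_ ∅ S
  ... | yes _  | _ = refl
  ... | no ∅≢∅ | _ = contradiction refl ∅≢∅

  h-S : S ≢ ∅ → h G S m k S ≡ [ + ∣E∣ - sumOver (extend₀ m) (∁ S) ]
  h-S S≢∅ with ≡-dec _≟ᵇ_ S ∅ | ≡-dec _≟ᵇ_ S S
  ... | yes S≡∅ | _       = contradiction S≡∅ S≢∅
  ... | no  _   | yes _   = refl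
  ... | no  _   | no  S≢S = contradiction refl S≢S

  h-proper : ∀ {Z} → Z ≢ ∅ → Z ≢ S → h G S m k Z ≡
    [ max⊆ (∁ S) (λ X → + k + + i G (Z ∪ X) - sumOver (extend₀ m) X) ]
  h-proper {Z} Z≢∅ Z≢S with ≡-dec _≟ᵇ_ Z ∅ | ≡-dec _≟ᵇ_ Z S
  ... | yes Z≡∅ | _       = contradiction Z≡∅ Z≢∅
  ... | no  _   | yes Z≡S = contradiction Z≡S Z≢S
  ... | no  _   | no  _   = refl

  -- The bound h(Z) is the family of constraints for the splitting sets Z ∪ X, with y(X) = m(X)
  -- moved to the other side. The value h(S) is y(V) - y(V - S).
  feasible⇒joinedBase : ∀ {y} → Feasible y → JoinedBase G S m k y
  feasible⇒joinedBase {y} fy = mS , (base-total , base-bound) , joined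
    where
    mS : ℤ^ S
    mS v _ = y v

    joined : ∀ v → y v ≡ join mS m v
    joined v with v ∈? S
    ... | yes _   = refl
    ... | no  v∉S = trans (spec fy v (x∉p⇒x∈∁p v∉S)) (extend₀-∈ m (x∉p⇒x∈∁p v∉S))

    sumOver-mS : ∀ {Z} → Z ⊆ S → sumOver (extend₀ mS) Z ≡ sumOver y Z
    sumOver-mS {Z} Z⊆S = sumOver-cong Z λ v v∈Z → extend₀-∈ mS (Z⊆S v∈Z)

    sumOver-m : ∀ {X} → X ⊆ ∁ S → sumOver (extend₀ m) X ≡ sumOver y X
    sumOver-m {X} X⊆∁S = sumOver-cong X λ v v∈X → sym (spec fy v (X⊆∁S v∈X))

    base-total : [ sumOver (extend₀ mS) S ] ≡ h G S m k S
    base-total = cases (≡-dec _≟ᵇ_ S ∅)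
      where
      open ≡-Reasoning
      cases : Dec (S ≡ ∅) → [ sumOver (extend₀ mS) S ] ≡ h G S m k S
      cases (yes refl) = trans (cong [_] (sumOver-∅ (extend₀ mS))) (sym h-∅)
      cases (no S≢∅) = trans (cong [_] (begin
        sumOver (extend₀ mS) S                          ≡⟨ sumOver-mS (λ v∈S → v∈S) ⟩
        sumOver y S                                     ≡⟨ solve 2 (λ a b → a := a :+ b :- b) refl (sumOver y S) (sumOver y (∁ S)) ⟩
        sumOver y S + sumOver y (∁ S) - sumOver y (∁ S) ≡⟨ cong₂ _-_ (trans (sumOver-∁ y S) (total fy)) (sym (sumOver-m λ v∉S → v∉S)) ⟩
        + ∣E∣ - sumOver (extend₀ m) (∁ S)               ∎)) (sym (h-S S≢∅))

    base-bound : ∀ Z → Z ⊂ S → h G S m k Z ≤₋ [ sumOver (extend₀ mS) Z ]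
    base-bound Z (Z⊆S , s , s∈S , s∉Z) with nonempty? Z
    ... | no empty with refl ← Empty-unique empty = subst₂ _≤₋_ (sym h-∅) (cong [_] (sym (sumOver-∅ (extend₀ mS)))) [ ≤-refl ]≤
    ... | yes (t , t∈Z) = subst (_≤₋ [ sumOver (extend₀ mS) Z ])
      (sym (h-proper (λ { refl → ∉⊥ t∈Z }) (λ { refl → s∉Z s∈S })))
      [ max⊆-lub (∁ S) _ bound ]≤
      where
      bound : ∀ X → X ⊆ ∁ S → + k + + i G (Z ∪ X) - sumOver (extend₀ m) X ≤ sumOver (extend₀ mS) Z
      bound X X⊆∁S = subst₂ _≤_
        (cong₂ (λ a b → + k + a - b) (sym (i≡induced G (Z ∪ X))) (sym (sumOver-m X⊆∁S))) (sym (sumOver-mS Z⊆S))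
        (≤-shift
        (splits fy (Z ∪ X) ((t , Z⊆S t∈Z , x∈p∪q⁺ (inj₁ t∈Z)) , s , s∈S , s∉Z∪X))
        (trans (cong (_+ (+ k + induced G (Z ∪ X) - sumOver y X))
                 (sumOver-disjoint y λ v∈Z v∈X → x∈∁p⇒x∉p (X⊆∁S v∈X) (Z⊆S v∈Z)))
          (solve 4 (λ z x k i → z :+ x :+ (k :+ i :- x) := z :+ (i :+ k)) refl
            (sumOver y Z) (sumOver y X) (+ k) (induced G (Z ∪ X)))))
        where
        s∉Z∪X : s ∉ Z ∪ X
        s∉Z∪X s∈Z∪X with x∈p∪q⁻ Z X s∈Z∪X
        ... | inj₁ s∈Z = s∉Z s∈Z
        ... | inj₂ s∈X = x∈∁p⇒x∉p (X⊆∁S s∈X) s∈S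

  -- On sets avoiding S, y agrees with the in-degrees `x₀` of the realizing orientation; by equality
  -- of totals it does so on sets containing S as well. A set Y splitting S is bounded through h(Y ∩
  -- S), with X = Y - S as a candidate in the maximum.
  joinedBase⇒feasible : Realizable G S m → ∀ {y} → JoinedBase G S m k y → Feasible y
  joinedBase⇒feasible (o₀ , meets) {y} (mS , (base-total , base-bound) , joined) = record
    { total  = trans y-total (sum-indegree G o₀)
    ; covers = y-covers
    ; splits = y-splits
    ; spec   = y≡m
    }
    where
    x₀ = indegree (orient G o₀)

    y≡mS : ∀ v → v ∈ S → y v ≡ extend₀ mS v
    y≡mS v v∈S with v ∈? S | joined v
    ... | yes _   | eq = eq
    ... | no  v∉S | _  = contradiction v∈S v∉S

    y≡m : ∀ v → v ∈ ∁ S → y v ≡ extend₀ m v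
    y≡m v v∈∁S with v ∈? S | joined v
    ... | yes v∈S | _  = contradiction v∈S (x∈∁p⇒x∉p v∈∁S)
    ... | no  _   | eq = trans eq (sym (extend₀-∈ m v∈∁S))

    outside-S : ∀ {X} → X ⊆ ∁ S → sumOver y X ≡ sumOver x₀ X
    outside-S {X} X⊆∁S = sumOver-cong X λ v v∈X →
      trans (y≡m v (X⊆∁S v∈X)) (sym (indegree-spec o₀ meets v (X⊆∁S v∈X)))

    y-S : sumOver y S ≡ sumOver x₀ S
    y-S = cases (≡-dec _≟ᵇ_ S ∅)
      where
      open ≡-Reasoning
      cases : Dec (S ≡ ∅) → sumOver y S ≡ sumOver x₀ S
      -- For S = ∅ the value h(S) is 0 by definition and says nothing about |E|; the total of y then
      -- comes from `o₀` through `outside-S`.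
      cases (yes refl) = trans (sumOver-∅ y) (sym (sumOver-∅ x₀))
      cases (no S≢∅) = begin
        sumOver y S                        ≡⟨ sumOver-cong S y≡mS ⟩
        sumOver (extend₀ mS) S             ≡⟨ []-injective (trans base-total (h-S S≢∅)) ⟩
        + ∣E∣ - sumOver (extend₀ m) (∁ S)  ≡⟨ cong₂ _-_ (trans (sym (sum-indegree G o₀)) (sym (sumOver-∁ x₀ S)))
                                                (sumOver-cong (∁ S) λ v v∉S → sym (indegree-spec o₀ meets v v∉S)) ⟩
        sumOver x₀ S + sumOver x₀ (∁ S) - sumOver x₀ (∁ S)
                                           ≡⟨ solve 2 (λ a b → a :+ b :- b := a) refl (sumOver x₀ S) (sumOver x₀ (∁ S)) ⟩
        sumOver x₀ S                       ∎

    y-total : sumOver y full ≡ sumOver x₀ full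
    y-total = trans (sym (sumOver-∁ y S)) (trans (cong₂ _+_ y-S (outside-S λ v∉S → v∉S)) (sumOver-∁ x₀ S))

    y-splits : ∀ Y → Splits S Y → induced G Y + + k ≤ sumOver y Y
    y-splits Y ((t , t∈S , t∈Y) , (s , s∈S , s∉Y)) =
      subst (λ W → induced G W + + k ≤ sumOver y W) Z∪X≡Y (≤-shift bound
        (trans (solve 4 (λ z x k i → z :+ (i :+ k) := z :+ x :+ (k :+ i :- x)) refl
                    (sumOver y Z) (sumOver y X) (+ k) (induced G (Z ∪ X)))
            (cong (_+ (+ k + induced G (Z ∪ X) - sumOver y X))
              (sym (sumOver-disjoint y λ v∈Z v∈X →
                x∈∁p⇒x∉p (proj₂ (x∈p∩q⁻ Y (∁ S) v∈X)) (proj₂ (x∈p∩q⁻ Y S v∈Z)))))))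
      where
      Z = Y ∩ S
      X = Y ∩ ∁ S
      Z∪X≡Y : Z ∪ X ≡ Y
      Z∪X≡Y = trans (sym (∩-distribˡ-∪ Y S (∁ S))) (trans (cong (Y ∩_) (∪-inverseʳ S)) (∩-identityʳ Y))
      Z⊆S : Z ⊆ S
      Z⊆S v∈Z = proj₂ (x∈p∩q⁻ Y S v∈Z)
      s∉Z : s ∉ Z
      s∉Z s∈Z = s∉Y (proj₁ (x∈p∩q⁻ Y S s∈Z))
      t∈Z : t ∈ Z
      t∈Z = x∈p∩q⁺ (t∈Y , t∈S)
      hZ≤ = subst (_≤₋ [ sumOver (extend₀ mS) Z ])
        (h-proper (λ Z≡∅ → ∉⊥ (subst (t ∈_) Z≡∅ t∈Z)) (λ Z≡S → s∉Z (subst (s ∈_) (sym Z≡S) s∈S)))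
        (base-bound Z (Z⊆S , s , s∈S , s∉Z))
      bound : + k + induced G (Z ∪ X) - sumOver y X ≤ sumOver y Z
      bound = subst₂ _≤_
        (cong₂ (λ a b → + k + a - b) (i≡induced G (Z ∪ X)) (sumOver-cong X λ v v∈X → sym (y≡m v (proj₂ (x∈p∩q⁻ Y (∁ S) v∈X)))))
        (sumOver-cong Z λ v v∈Z → sym (y≡mS v (Z⊆S v∈Z)))
        (≤-trans (max⊆-upper (∁ S) _ {X} (λ v∈X → proj₂ (x∈p∩q⁻ Y (∁ S) v∈X))) ([≤]-injective hZ≤))

    y-covers : ∀ Y → induced G Y ≤ sumOver y Y
    y-covers Y with any? (λ t → (t ∈? S) ×-dec (t ∈? Y)) | any? (λ s → (s ∈? S) ×-dec ¬? (s ∈? Y))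
    ... | yes t∈ | yes s∉ = ≤-trans (i≤i+j (induced G Y) (+ k)) (y-splits Y (t∈ , s∉))
    ... | no ¬t∈ | _      = subst (induced G Y ≤_)
      (sym (outside-S λ {v} v∈Y → x∉p⇒x∈∁p λ v∈S → ¬t∈ (v , v∈S , v∈Y))) (indegree-covers G o₀ Y)
    ... | yes _  | no ¬s∉ = subst (induced G Y ≤_)
      (sym (sumOver-∁-cong y x₀ {Y} y-total
        (outside-S λ {v} v∈∁Y → x∉p⇒x∈∁p λ v∈S → ¬s∉ (v , v∈S , x∈∁p⇒x∉p v∈∁Y)))) (indegree-covers G o₀ Y)

  -- The exchange property.

  module Exchange {x y} (fx : Feasible x) (fy : Feasible y) {u} (yu<xu : y u < x u) where

    agree : ∀ v → v ∉ S → x v ≡ y v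
    agree v v∉S = trans (spec fx v (x∉p⇒x∈∁p v∉S)) (sym (spec fy v (x∉p⇒x∈∁p v∉S)))

    u∈S : u ∈ S
    u∈S = decidable-stable (u ∈? S) λ u∉S → <-irrefl (sym (agree u u∉S)) yu<xu

    v∈S : ∀ {v} → x v < y v → v ∈ S
    v∈S {v} xv<yv = decidable-stable (v ∈? S) λ v∉S → <-irrefl (agree v v∉S) xv<yv

    -- Such a T forbids moving a unit from u to v. Tightness refers to the bound with k: when x(v) <
    -- y(v), both u and v lie in S, so a set containing u but not v splits S.
    Separates : Fin n → Subset n → Set
    Separates v T = u ∈ T × v ∉ T × sumOver x T ≡ induced G T + + k

    separates? : ∀ v T → Dec (Separates v T)
    separates? v T = (u ∈? T) ×-dec (¬? (v ∈? T) ×-dec (sumOver x T ≟ᶻ induced G T + + k))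

    record Tight (T : Subset n) : Set where
      constructor mkTight
      field
        u∈T    : u ∈ T
        missed : ∃ λ s → s ∈ S × s ∉ T
        tight  : sumOver x T ≡ induced G T + + k

      T-splits : Splits S T
      T-splits = (u , u∈S , u∈T) , missed
    open Tight

    -- Uncrossing: a node of S outside both sets, together with u inside both, makes T ∩ T′ and T ∪
    -- T′ split S. Supermodularity of `induced` then leaves no slack at T ∩ T′.
    tight-∩ : ∀ {T T′} → Tight T → Tight T′ → (∃ λ s → s ∈ S × s ∉ T × s ∉ T′) → Tight (T ∩ T′)
    tight-∩ {T} {T′} p q (s , s∈S , s∉T , s∉T′) = mkTight
      u∈∩ missed∩
      (≤-antisym
        (≤-shift (+-mono-≤ (induced-supermodular G T T′) (splits fx (T ∪ T′) ∪-splits))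
          (trans (solve 4 (λ i∩ i∪ x∩ x∪ → i∩ :+ i∪ :+ x∪ :+ x∩ := x∩ :+ x∪ :+ (i∩ :+ i∪)) refl
                   (induced G (T ∩ T′)) (induced G (T ∪ T′)) (sumOver x (T ∩ T′)) (sumOver x (T ∪ T′)))
          (trans (cong (_+ (induced G (T ∩ T′) + induced G (T ∪ T′)))
                   (trans (sym (sumOver-modular x T T′)) (cong₂ _+_ (tight p) (tight q))))
            (solve 5 (λ i i′ k i∩ i∪ → i :+ k :+ (i′ :+ k) :+ (i∩ :+ i∪) := i∩ :+ k :+ (i :+ i′ :+ (i∪ :+ k))) refl
              (induced G T) (induced G T′) (+ k) (induced G (T ∩ T′)) (induced G (T ∪ T′))))))
        (splits fx (T ∩ T′) ((u , u∈S , u∈∩) , missed∩)))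
      where
      u∈∩ : u ∈ T ∩ T′
      u∈∩ = x∈p∩q⁺ (u∈T p , u∈T q)
      missed∩ : ∃ λ s → s ∈ S × s ∉ T ∩ T′
      missed∩ = s , s∈S , s∉T ∘ proj₁ ∘ x∈p∩q⁻ T T′
      s∉∪ : s ∉ T ∪ T′
      s∉∪ s∈∪ with x∈p∪q⁻ T T′ s∈∪
      ... | inj₁ s∈T  = s∉T s∈T
      ... | inj₂ s∈T′ = s∉T′ s∈T′
      ∪-splits : Splits S (T ∪ T′)
      ∪-splits = (u , u∈S , x∈p∪q⁺ (inj₁ (u∈T p))) , s , s∈S , s∉∪

    -- Intersections of tight sets whose complements are pairwise disjoint on S.
    data Codisjoint : Subset n → Set where
      none : Codisjoint full
      more : ∀ {R T} → Codisjoint R → Tight T → (∀ v → v ∈ S → v ∈ R ⊎ v ∈ T) → Codisjoint (R ∩ T)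

    -- Inserts T into the family. A member T′ whose complement meets that of T within S is merged
    -- with T into the tight set T′ ∩ T, which is inserted into the rest; any other member is kept.
    refine : ∀ {R T} → Codisjoint R → Tight T → Codisjoint (R ∩ T)
    refine none p = more none p λ v _ → inj₁ ∈⊤
    refine {T = T} (more {R} {T′} c q cover) p
      with any? (λ s → (s ∈? S) ×-dec (¬? (s ∈? T′) ×-dec ¬? (s ∈? T)))
    ... | yes missed = subst Codisjoint (sym (∩-assoc R T′ T)) (refine c (tight-∩ q p missed))
    ... | no ¬missed = subst Codisjoint
      (trans (∩-assoc R T T′) (trans (cong (R ∩_) (∩-comm T T′)) (sym (∩-assoc R T′ T))))
      (more (refine c p) q cover′)
      where
      cover′ : ∀ v → v ∈ S → v ∈ R ∩ T ⊎ v ∈ T′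
      cover′ v v∈S with v ∈? T′ | v ∈? T | cover v v∈S
      ... | yes v∈T′ | _       | _         = inj₂ v∈T′
      ... | no  v∉T′ | no  v∉T | _         = contradiction (v , v∈S , v∉T′ , v∉T) ¬missed
      ... | no  v∉T′ | yes v∈T | inj₁ v∈R  = inj₁ (x∈p∩q⁺ (v∈R , v∈T))
      ... | no  v∉T′ | yes v∈T | inj₂ v∈T′ = contradiction v∈T′ v∉T′

    codisjoint-u : ∀ {R} → Codisjoint R → u ∈ R
    codisjoint-u none         = ∈⊤
    codisjoint-u (more c p _) = x∈p∩q⁺ (codisjoint-u c , u∈T p)

    -- As R ∪ T contains S, x and y agree outside it and hence have equal sums on it. By modularity,
    -- x(R) ≤ y(R) and x(T) = i(T) + k ≤ y(T) then give the bound on R ∩ T.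
    codisjoint-≤ : ∀ {R} → Codisjoint R → sumOver x R ≤ sumOver y R
    codisjoint-≤ none = ≤-reflexive (trans (total fx) (sym (total fy)))
    codisjoint-≤ (more {R} {T} c p cover) =
      ≤-shift (+-mono-≤ (codisjoint-≤ c) (≤-trans (≤-reflexive (tight p)) (splits fy T (T-splits p))))
        (begin
          sumOver y R + sumOver y T + sumOver x (R ∩ T)
            ≡⟨ cong (_+ sumOver x (R ∩ T)) (sumOver-modular y R T) ⟩
          sumOver y (R ∩ T) + sumOver y (R ∪ T) + sumOver x (R ∩ T)
            ≡⟨ cong (λ z → sumOver y (R ∩ T) + z + sumOver x (R ∩ T)) (sym ∪-same) ⟩
          sumOver y (R ∩ T) + sumOver x (R ∪ T) + sumOver x (R ∩ T)
            ≡⟨ solve 3 (λ a b c → a :+ b :+ c := a :+ (c :+ b)) refl (sumOver y (R ∩ T)) (sumOver x (R ∪ T)) (sumOver x (R ∩ T)) ⟩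
          sumOver y (R ∩ T) + (sumOver x (R ∩ T) + sumOver x (R ∪ T))
            ≡⟨ cong (_+_ (sumOver y (R ∩ T))) (sumOver-modular x R T) ⟨
          sumOver y (R ∩ T) + (sumOver x R + sumOver x T) ∎)
      where
      open ≡-Reasoning
      ∪-same : sumOver x (R ∪ T) ≡ sumOver y (R ∪ T)
      ∪-same = sumOver-∁-cong x y {R ∪ T} (trans (total fx) (sym (total fy)))
        (sumOver-cong (∁ (R ∪ T)) λ v v∉∪ → agree v λ v∈S → x∈∁p⇒x∉p v∉∪ (x∈p∪q⁺ (cover v v∈S)))

    -- If every v with x(v) < y(v) were separated from u by a tight set, the
    -- intersection R of such sets would satisfy x(R) ≤ y(R), although y ≤ x on R
    -- with strict inequality at u.
    unseparated : ¬ (∀ v → x v < y v → ∃ (Separates v))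
    unseparated sep = shrink n full (∣p∣≤n full) none
      where
      strict : ∀ {R} → u ∈ R → (∀ v → v ∈ R → y v ≤ x v) → sumOver y R < sumOver x R
      strict {R} u∈R y≤x = sum-mono-< weak u at-u
        where
        weak : ∀ v → (if lookup R v then y v else 0ℤ) ≤ (if lookup R v then x v else 0ℤ)
        weak v with lookup R v in eq
        ... | true  = y≤x v (lookup⇒[]= v R eq)
        ... | false = ≤-refl
        at-u : (if lookup R u then y u else 0ℤ) < (if lookup R u then x u else 0ℤ)
        at-u rewrite []=⇒lookup u∈R = yu<xu

      -- Any v in R with x(v) < y(v) is removed by intersecting with a tight set that separates it,
      -- so |R| bounds the number of rounds.
      shrink : ∀ N R → ∣ R ∣ ℕ.≤ N → ¬ Codisjoint R
      shrink N R size c with any? (λ v → (v ∈? R) ×-dec (x v <? y v))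
      ... | no done = <⇒≱ (strict (codisjoint-u c) λ v v∈R → ≮⇒≥ λ xv<yv → done (v , v∈R , xv<yv)) (codisjoint-≤ c)
      ... | yes (v , v∈R , xv<yv) with T , u∈T , v∉T , T-tight ← sep v xv<yv = descend N
        (ℕₚ.<-≤-trans (p⊂q⇒∣p∣<∣q∣ (p∩q⊆p R T , v , v∈R , v∉T ∘ proj₂ ∘ x∈p∩q⁻ R T)) size)
        where
        descend : ∀ N → ∣ R ∩ T ∣ ℕ.< N → _
        descend (suc N) size′ = shrink N (R ∩ T) (ℕ.s≤s⁻¹ size′) (refine c (mkTight u∈T (v , v∈S xv<yv , v∉T) T-tight))

    -- Only sets containing u but not v lose a unit. These split S and are not tight, since a tight
    -- one would separate v from u; so one unit is to spare.
    transfer-feasible : ∀ {v} → x v < y v → ¬ ∃ (Separates v) → Feasible (transfer u v x)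
    transfer-feasible {v} xv<yv unsep = record
      { total  = begin
          sumOver (transfer u v x) full ≡⟨ sumOver-transfer u v x full ⟩
          sumOver x full + -1ℤ * ⟦ lookup full u ⟧ + 1ℤ * ⟦ lookup full v ⟧
            ≡⟨ cong₂ (λ p q → sumOver x full + -1ℤ * ⟦ p ⟧ + 1ℤ * ⟦ q ⟧) (lookup-replicate u true) (lookup-replicate v true) ⟩
          sumOver x full + -1ℤ * 1ℤ + 1ℤ * 1ℤ
            ≡⟨ solve 1 (λ x → x :+ con -1ℤ :* con 1ℤ :+ con 1ℤ :* con 1ℤ := x) refl (sumOver x full) ⟩
          sumOver x full ≡⟨ total fx ⟩
          + ∣E∣ ∎
      ; covers = λ X → subst (_≤ sumOver (transfer u v x) X) (+-identityʳ (induced G X))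
          (lower X 0ℤ (+≤+ ℕ.z≤n) (subst (_≤ sumOver x X) (sym (+-identityʳ (induced G X))) (covers fx X)))
      ; splits = λ X X-splits → lower X (+ k) ≤-refl (splits fx X X-splits)
      ; spec   = λ w w∉S → trans (fixed w (x∈∁p⇒x∉p w∉S)) (spec fx w w∉S)
      }
      where
      open ≡-Reasoning
      fixed : ∀ w → w ∉ S → transfer u v x w ≡ x w
      fixed w w∉S rewrite δ-≢ {u = u} {w} (λ { refl → w∉S u∈S }) | δ-≢ {u = v} {w} (λ { refl → w∉S (v∈S xv<yv) }) =
        solve 1 (λ x → x :+ con -1ℤ :* con 0ℤ :+ con 1ℤ :* con 0ℤ := x) refl (x w)

      -- Serves `covers` with c = 0 and `splits` with c = k.
      lower : ∀ X c → c ≤ + k → induced G X + c ≤ sumOver x X → induced G X + c ≤ sumOver (transfer u v x) X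
      lower X c c≤k le rewrite sumOver-transfer u v x X with lookup X u in u∈X | lookup X v in v∈X
      ... | true  | true  = ≤-shift le
        (solve 2 (λ x i → x :+ i := x :+ con -1ℤ :* con 1ℤ :+ con 1ℤ :* con 1ℤ :+ i) refl (sumOver x X) (induced G X + c))
      ... | false | true  = ≤-shift (+-mono-≤ le 0≤⟦ true ⟧)
        (solve 2 (λ x i → x :+ con 1ℤ :+ i := x :+ con -1ℤ :* con 0ℤ :+ con 1ℤ :* con 1ℤ :+ (i :+ con 0ℤ)) refl (sumOver x X) (induced G X + c))
      ... | false | false = ≤-shift le
        (solve 2 (λ x i → x :+ i := x :+ con -1ℤ :* con 0ℤ :+ con 1ℤ :* con 0ℤ :+ i) refl (sumOver x X) (induced G X + c))
      ... | true  | false = ≤-shift (+-mono-≤ (i<j⇒suc[i]≤j (≤∧≢⇒< X-bound not-tight)) c≤k)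
        (solve 4 (λ x i c k → x :+ k :+ (i :+ c) := x :+ con -1ℤ :* con 1ℤ :+ con 1ℤ :* con 0ℤ :+ (con 1ℤ :+ (i :+ k) :+ c)) refl
          (sumOver x X) (induced G X) c (+ k))
        where
        X-bound : induced G X + + k ≤ sumOver x X
        X-bound = splits fx X ((u , u∈S , lookup⇒[]= u X u∈X) , (v , v∈S xv<yv , lookup⇒∉ v∈X))
        not-tight : induced G X + + k ≢ sumOver x X
        not-tight eq = unsep (X , lookup⇒[]= u X u∈X , lookup⇒∉ v∈X , sym eq)

    exchange : ∃ λ v → x v < y v × Feasible (transfer u v x)
    exchange with any? (λ v → (x v <? y v) ×-dec ¬? (anySubset? (separates? v)))
    ... | yes (v , xv<yv , unsep) = v , xv<yv , transfer-feasible xv<yv unsep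
    ... | no  stuck = contradiction
      (λ v xv<yv → decidable-stable (anySubset? (separates? v)) λ unsep → stuck (v , xv<yv , unsep)) unseparated

  -- Minimisers among the feasible vectors, and M-convexity.

  Minimises : Subset n → (Fin n → ℤ) → Set
  Minimises Z x = ∀ z → Feasible z → sumOver x Z ≤ sumOver z Z

  -- The unit leaves Z at u and may return to Z at v, so the sum over Z cannot grow.
  transfer-minimises : ∀ {Z u v x} → u ∈ Z → Minimises Z x → Minimises Z (transfer u v x)
  transfer-minimises {Z} {u} {v} {x} u∈Z min z fz = ≤-trans drop (min z fz)
    where
    drop : sumOver (transfer u v x) Z ≤ sumOver x Z
    drop rewrite sumOver-transfer u v x Z | []=⇒lookup u∈Z with lookup Z v
    ... | true  = ≤-reflexive (solve 1 (λ x → x :+ con -1ℤ :* con 1ℤ :+ con 1ℤ :* con 1ℤ := x) refl (sumOver x Z))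
    ... | false = ≤-shift 0≤⟦ true ⟧ (solve 1 (λ x → con 1ℤ :+ (x :+ con -1ℤ :* con 1ℤ :+ con 1ℤ :* con 0ℤ) := x :+ con 0ℤ) refl (sumOver x Z))

  -- Exchanges inside A move x towards y, and exchanges inside C move y towards x;
  -- when neither is possible, x and y agree on A.
  common-minimiser : ∀ N {A C x y} → A ⊆ C → Feasible x → Feasible y → Minimises A x → Minimises C y →
    excess (λ v → x v - y v) ≤ + N → ∃ λ z → Feasible z × Minimises A z × Minimises C z
  common-minimiser N {A} {C} {x} {y} A⊆C fx fy minA minC dist
    with any? (λ u → (u ∈? A) ×-dec (y u <? x u)) | any? (λ v → (v ∈? C) ×-dec (x v <? y v))
  ... | yes (u , u∈A , yu<xu) | _ with w , xw<yw , fx′ ← Exchange.exchange fx fy yu<xu =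
    closer N (<-≤-trans (excess-transfer
      (λ v → solve 4 (λ x y u w → x :+ con -1ℤ :* u :+ con 1ℤ :* w :- y := x :- y :+ con -1ℤ :* u :+ con 1ℤ :* w) refl
               (x v) (y v) (δ u v) (δ w v))
      (i<j⇒0<j-i yu<xu) (i<j⇒i-j<0 xw<yw)) dist)
    where
    closer : ∀ N → excess (λ v → transfer u w x v - y v) < + N → _
    closer zero    d<0 = contradiction (excess≥0 {n} _) (<⇒≱ d<0)
    closer (suc N) d<N = common-minimiser N A⊆C fx′ fy (transfer-minimises {v = w} u∈A minA) minC (i<j⇒i≤pred[j] d<N)
  common-minimiser N {A} {C} {x} {y} A⊆C fx fy minA minC dist
      | no _ | yes (u , u∈C , xu<yu) with w , yw<xw , fy′ ← Exchange.exchange fy fx xu<yu =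
    -- Moving a unit of y from u to w acts on x - y as a transfer from w to u.
    closer N (<-≤-trans (excess-transfer
      (λ v → solve 4 (λ x y u w → x :- (y :+ con -1ℤ :* u :+ con 1ℤ :* w) := x :- y :+ con -1ℤ :* w :+ con 1ℤ :* u) refl
               (x v) (y v) (δ u v) (δ w v))
      (i<j⇒0<j-i yw<xw) (i<j⇒i-j<0 xu<yu)) dist)
    where
    closer : ∀ N → excess (λ v → x v - transfer u w y v) < + N → _
    closer zero    d<0 = contradiction (excess≥0 {n} _) (<⇒≱ d<0)
    closer (suc N) d<N = common-minimiser N A⊆C fx fy′ minA (transfer-minimises {v = w} u∈C minC) (i<j⇒i≤pred[j] d<N)
  common-minimiser N {A} {C} {x} {y} A⊆C fx fy minA minC dist
      | no noA | no noC = y , fy , (λ z fz → ≤-trans (≤-reflexive (sumOver-cong A same)) (minA z fz)) , minC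
    where
    same : ∀ v → v ∈ A → y v ≡ x v
    same v v∈A = ≤-antisym (≮⇒≥ λ xv<yv → noC (v , A⊆C v∈A , xv<yv)) (≮⇒≥ λ yv<xv → noA (v , v∈A , yv<xv))

  -- An orientation is a Boolean vector, hence a `Subset` of the edges, so `anySubset?` can search
  -- all orientations. By `realise` this searches all feasible vectors.
  feasible? : ∀ (o : Orientation G) → Dec (Feasible (indegree (orient G o)))
  feasible? o
    with anySubset? (λ X → splits? S X ×-dec ¬? (induced G X + + k ≤? sumOver (indegree (orient G o)) X))
       | any? (λ v → (v ∈? ∁ S) ×-dec ¬? (indegree (orient G o) v ≟ᶻ extend₀ m v))
  ... | yes (X , X-splits , ¬bound) | _ = no λ f → ¬bound (splits f X X-splits)
  ... | no _ | yes (v , v∉S , differ)  = no λ f → differ (spec f v v∉S)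
  ... | no ok-splits | no ok-spec = yes record
    { total  = sum-indegree G o
    ; covers = indegree-covers G o
    ; splits = λ X X-splits → decidable-stable (_ ≤? _) λ ¬bound → ok-splits (X , X-splits , ¬bound)
    ; spec   = λ v v∉S → decidable-stable (_ ≟ᶻ _) λ differ → ok-spec (v , v∉S , differ)
    }

  realise : ∀ {y} → Feasible y → ∃ λ (o : Orientation G) → ∀ v → indegree (orient G o) v ≡ y v
  realise fy = hakimi G _ (total fy) (covers fy)

  induced≥0 : ∀ X → 0ℤ ≤ induced G X
  induced≥0 X = subst (0ℤ ≤_) (i≡induced G X) (+≤+ ℕ.z≤n)

  -- Descent: while some orientation has a feasible in-degree vector with a smaller sum over Z, it
  -- replaces the current vector. The sums are integers bounded below by i(Z) ≥ 0, so this stops.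
  minimiser : ∀ {x} → Feasible x → ∀ Z → ∃ λ z → Feasible z × Minimises Z z
  minimiser {x} fx Z = search _ fx (≤-reflexive (sym (0≤i⇒+∣i∣≡i (≤-trans (induced≥0 Z) (covers fx Z)))))
    where
    search : ∀ N {x} → Feasible x → sumOver x Z ≤ + N → ∃ λ z → Feasible z × Minimises Z z
    search N {x} fx bound
      with anySubset? (λ o → feasible? o ×-dec (sumOver (indegree (orient G o)) Z <? sumOver x Z))
    ... | no minimal = x , fx , λ z fz → let o , o≡z = realise fz in ≮⇒≥ λ z<x →
      minimal (o , feasible-resp (sym ∘ o≡z) fz ,
               subst (_< sumOver x Z) (sumOver-cong Z λ v _ → sym (o≡z v)) z<x)
    ... | yes (o , fo , o<x) = smaller N (<-≤-trans o<x bound)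
      where
      smaller : ∀ N → sumOver (indegree (orient G o)) Z < + N → ∃ λ z → Feasible z × Minimises Z z
      smaller zero    o<0 = contradiction (≤-trans (induced≥0 Z) (covers fo Z)) (<⇒≱ o<0)
      smaller (suc N) o<N = search N fo (i<j⇒i≤pred[j] o<N)

  mConvex : MConvex (InDegreeVector G S m k)
  mConvex with anySubset? feasible?
  ... | no none = inj₁ λ y Iy → let fy = inDegreeVector⇒feasible Iy ; o , o≡y = realise fy in
    none (o , feasible-resp (sym ∘ o≡y) fy)
  ... | yes (o₀ , f₀) = inj₂ (p , supermodular , cong [_] (sumOver-∅ (best ∅)) , (λ ()) , λ x → mk⇔ (to x) (from x))
    where
    best : Subset n → Fin n → ℤ
    best Z = proj₁ (minimiser f₀ Z)

    best-feasible : ∀ Z → Feasible (best Z)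
    best-feasible Z = proj₁ (proj₂ (minimiser f₀ Z))

    best-minimises : ∀ Z → Minimises Z (best Z)
    best-minimises Z = proj₂ (proj₂ (minimiser f₀ Z))

    p : Subset n → ℤ ₋
    p Z = [ sumOver (best Z) Z ]

    -- Any feasible z bounds p(X) + p(Y) by z(X) + z(Y). Modularity rewrites this in terms of X ∩ Y
    -- and X ∪ Y, where the common minimiser attains p.
    supermodular : Supermodular p
    supermodular X Y
      with z , fz , min∩ , min∪ ← common-minimiser _ (p⊆p∪q Y ∘ p∩q⊆p X Y)
             (best-feasible (X ∩ Y)) (best-feasible (X ∪ Y)) (best-minimises (X ∩ Y)) (best-minimises (X ∪ Y))
             (≤-reflexive (sym (0≤i⇒+∣i∣≡i (excess≥0 {n} _)))) = [ begin
      sumOver (best X) X + sumOver (best Y) Y ≤⟨ +-mono-≤ (best-minimises X z fz) (best-minimises Y z fz) ⟩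
      sumOver z X + sumOver z Y               ≡⟨ sumOver-modular z X Y ⟩
      sumOver z (X ∩ Y) + sumOver z (X ∪ Y)   ≤⟨ +-mono-≤ (min∩ _ (best-feasible (X ∩ Y))) (min∪ _ (best-feasible (X ∪ Y))) ⟩
      sumOver (best (X ∩ Y)) (X ∩ Y) + sumOver (best (X ∪ Y)) (X ∪ Y) ∎ ]≤
      where open ≤-Reasoning

    to : ∀ x → InDegreeVector G S m k x → IntegralBase full p x
    to x Ix = cong [_] (trans (total fx) (sym (total (best-feasible full)))) , λ Z _ → [ best-minimises Z x fx ]≤
      where fx = inDegreeVector⇒feasible Ix

    from : ∀ x → IntegralBase full p x → InDegreeVector G S m k x
    from x (x-total , x-bound) = feasible⇒inDegreeVector record
      { total  = x-full
      ; covers = λ X → ≤-trans (covers (best-feasible X) X) (above X)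
      ; splits = λ X X-splits → ≤-trans (splits (best-feasible X) X X-splits) (above X)
      -- An equation, unlike the other constraints, needs two bounds: the minimisers for v and for V
      -- - v both take the value m(v) at v, which bounds x(v) from below and, via the total, from
      -- above.
      ; spec   = λ v v∉S → ≤-antisym
          (≤-shift (above (∁ ⁅ v ⁆)) (begin
            sumOver x (∁ ⁅ v ⁆) + x v
              ≡⟨ trans (+-comm _ (x v)) (whole x x-full v) ⟩
            + ∣E∣
              ≡⟨ whole (best (∁ ⁅ v ⁆)) (total (best-feasible (∁ ⁅ v ⁆))) v ⟨
            best (∁ ⁅ v ⁆) v + sumOver (best (∁ ⁅ v ⁆)) (∁ ⁅ v ⁆)
              ≡⟨ cong (_+ sumOver (best (∁ ⁅ v ⁆)) (∁ ⁅ v ⁆)) (spec (best-feasible (∁ ⁅ v ⁆)) v v∉S) ⟩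
            extend₀ m v + sumOver (best (∁ ⁅ v ⁆)) (∁ ⁅ v ⁆) ∎))
          (subst₂ _≤_ (trans (sumOver-⁅⁆ (best ⁅ v ⁆) v) (spec (best-feasible ⁅ v ⁆) v v∉S)) (sumOver-⁅⁆ x v) (above ⁅ v ⁆))
      }
      where
      open ≡-Reasoning
      x-full : sumOver x full ≡ + ∣E∣
      x-full = trans ([]-injective x-total) (total (best-feasible full))

      above : ∀ Z → sumOver (best Z) Z ≤ sumOver x Z
      -- `x-bound` covers proper subsets only; for Z = V the equality of totals takes its place.
      above Z with any? (λ v → ¬? (v ∈? Z))
      ... | yes (v , v∉Z) = [≤]-injective (x-bound Z (⊆⊤ , v , ∈⊤ , v∉Z))
      ... | no none with refl ← ⊆-antisym {i = Z} {j = full} ⊆⊤ (λ {v} _ → decidable-stable (v ∈? Z) λ v∉Z → none (v , v∉Z)) =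
        ≤-reflexive (sym ([]-injective x-total))

      whole : ∀ z → sumOver z full ≡ + ∣E∣ → ∀ v → z v + sumOver z (∁ ⁅ v ⁆) ≡ + ∣E∣
      whole z z-total v = trans (cong (_+ sumOver z (∁ ⁅ v ⁆)) (sym (sumOver-⁅⁆ z v))) (trans (sumOver-∁ z ⁅ v ⁆) z-total)

theorem6p9 : ∀ {n : ℕ} (G : Graph n) (k : ℕ) → 0 ℕ.< k →
    (S : Subset n) (m : ℤ^ (∁ S)) →
    MConvex (InDegreeVector G S m k)
    × (Realizable G S m →
    ∀ (y : Fin n → ℤ) → InDegreeVector G S m k y ⇔ JoinedBase G S m k y)
theorem6p9 G k _ S m = mConvex G S m k , λ realizable y → mk⇔
  (feasible⇒joinedBase G S m k ∘ inDegreeVector⇒feasible G S m k)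
  (feasible⇒inDegreeVector G S m k ∘ joinedBase⇒feasible G S m k realizable)
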